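{- For every composition $I$, the dual immaculate quasi-symmetric function $\mathfrak{S}_I^*$ is given by $$\mathfrak{S}_I^*=\overline{C_I(X)},$$ where $C_I(X)\in QSym$ is the commutative image of the coefficient $C_I(A)$ of $Y^I$ in the free Bell polynomial ${\bm B}_{|I|}$, and the bar is the linear involution of $QSym$ defined by $\overline{F_I}=F_{\bar I}$, with $\bar I=(i_r,\ldots,i_1)$ the mirror composition of $I=(i_1,\ldots,i_r)$.
   Context: Let $\mathbb K$ be the ground field (characteristic $0$). FQSym. Let $A=\{a_1<a_2<\cdots\}$ be a countably infinite totally ordered alphabet. The standardization $\mathrm{Std}(w)$ of a word $w$ of length $n$ is the unique permutation in $\mathfrak S_n$ (written as a word) with the same inversions as $w$. $\mathbf{FQSym}$ is the algebra spanned by $\mathbf G_\sigma=\sum_{w\in A^n,\ \mathrm{Std}(w)=\sigma}w$, for $\sigma\in\mathfrak S_n$, $n\ge 0$. For nonempty permutations $\alpha\in\mathfrak S_k$, $\beta\in\mathfrak S_l$ put $$\mathbf G_\alpha\prec\mathbf G_\beta=\sum_{\gamma}\mathbf G_\gamma,$$ where $\gamma$ ranges over the permutations in $\mathfrak S_{k+l}$ of the form $\gamma=uv$ with $|u|=k$, $\mathrm{Std}(u)=\alpha$, $\mathrm{Std}(v)=\beta$ and $\max(v)<\max(u)$; extend bilinearly. Let $S_n=\mathbf G_{12\cdots n}$. Free Bell polynomials. Let $Y_1,Y_2,\ldots$ be noncommuting indeterminates, and $Y^I=Y_{i_1}\cdots Y_{i_r}$ for a composition $I=(i_1,\ldots,i_r)$.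 Define ${\bm B}_n\in\mathbb K\langle Y_1,Y_2,\ldots\rangle\otimes\mathbf{FQSym}$ by ${\bm B}_0=1$ and ${\bm B}_{n+1}=\sum_{k=0}^n Y_{k+1}S_{k+1}\prec{\bm B}_{n-k}$, where $\prec$ multiplies the $Y$-parts by concatenation and the $\mathbf{FQSym}$-parts by $\prec$ (and $S_{n+1}\prec 1$ is understood as $S_{n+1}$). $C_I(A)\in\mathbf{FQSym}$ denotes the coefficient of $Y^I$ in ${\bm B}_{|I|}$; for nonempty $I$, $C_I(A)=S_{i_1}\prec(S_{i_2}\prec(\cdots(S_{i_{r-1}}\prec S_{i_r})\cdots))$. Commutative image. $QSym$ is the algebra of quasi-symmetric functions with fundamental basis $F_I$, indexed by compositions. The descent composition of a permutation $\sigma\in\mathfrak S_n$ is the composition of $n$ with descent set $\{i:\sigma_i>\sigma_{i+1}\}$. The commutative image $\mathbf{FQSym}\to QSym$ (letters $a_i$ replaced by commuting variables $x_i$) sends $\mathbf G_\sigma$ to $F_J$, where $J$ is the descent composition of $\sigma^{ -1}$; $C_I(X)$ denotes the image of $C_I(A)$. Dual immaculate basis. Let $\mathbf{Sym}$ be the algebra of noncommutative symmetric functions, freely generated by $S_1,S_2,\ldots$ ($S_0=1$, $S_m=0$ for $m<0$), in duality with $QSym$ via $\langle R_I,F_J\rangle=\delta_{IJ}$, where $R_I$ are the noncommutative ribbon Schur functions (equivalently $\langle S^I,M_J\rangle=\delta_{IJ}$, with $S^I=S_{i_1}\cdots S_{i_r}$ and $M_J$ the monomial quasi-symmetric functions).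 For $F\in QSym$, let $F^\perp$ be the linear operator on $\mathbf{Sym}$ defined by $\langle F^\perp H,G\rangle=\langle H,FG\rangle$ for all $G\in QSym$. For $m\in\mathbb Z$ set $\mathbb B_m=\sum_{i\ge 0}(-1)^iS_{m+i}F_{1^i}^\perp$ (where $1^i=(1,\ldots,1)$ with $i$ parts and $F_{1^0}=1$). The immaculate basis of $\mathbf{Sym}$ is $\mathfrak S_I=\mathbb B_{i_1}\mathbb B_{i_2}\cdots\mathbb B_{i_r}(1)$, for $I=(i_1,\ldots,i_r)$ a composition, and the dual immaculate basis $(\mathfrak S_I^*)$ is the basis of $QSym$ dual to it: $\langle\mathfrak S_I,\mathfrak S_J^*\rangle=\delta_{IJ}$. -}

module Defs where

open import Level using (_⊔_)
open import Algebra.Bundles using (CommutativeRing; Semiring)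
open import Algebra.Apartness.Bundles using (HeytingField; HeytingCommutativeRing)
open import Data.Fin.Base as Fin using (Fin; toℕ)
import Data.Fin.Properties as Fin
open import Data.Fin.Permutation using (Permutation′; _⟨$⟩ʳ_; insert; flip)
  renaming (id to idₚ)
open import Data.Integer.Base as ℤ using (ℤ; +_; -[1+_])
open import Data.List.Base
  using (List; []; _∷_; _++_; map; concatMap; filter; reverse; foldr; length; upTo; allFin; replicate)
open import Data.List.Extrema.Nat using (max)
open import Data.List.Properties using (≡-dec; concatMap-cong)
open import Data.List.Membership.Propositional using (_∈_)
open import Data.List.Membership.Propositional.Properties using (∈-map⁻; ∈-++⁻)
open import Data.List.Relation.Unary.All as All using (All; []; _∷_)
import Data.List.Relation.Unary.All.Properties as All
open import Data.List.Relation.Unary.Any using (here)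
import Data.List.Membership.DecPropositional as DecMembership
open import Data.Nat.Base as ℕ using (ℕ; zero; suc; _∸_; _<_; _≤_; z≤n; s≤s)
open import Data.Nat.ListAction using (sum)
import Data.Nat.Properties as ℕ
open import Data.Product.Base using (∃; _×_; _,_; proj₁; proj₂)
open import Data.Sum.Base using (_⊎_; inj₁; inj₂)
open import Data.Vec.Base as Vec using (Vec; []; _∷_)
open import Data.Vec.Functional using (Vector; toList; take; drop)
open import Function.Base using (_∘_)
open import Function.Bundles using (_⇔_; mk⇔; Equivalence)
open import Relation.Binary.Definitions using (DecidableEquality)
open import Relation.Binary.PropositionalEquality as ≡ using (_≡_; cong; cong₂)
open import Relation.Nullary.Decidable
  using (Dec; yes; no; map′; _×-dec_; _→-dec_)
open import Relation.Nullary.Negation using (¬_; contradiction)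

commutativeRing : ∀ {c ℓ₁ ℓ₂} → HeytingField c ℓ₁ ℓ₂ → CommutativeRing c ℓ₁
commutativeRing K =
  HeytingCommutativeRing.commutativeRing (HeytingField.heytingCommutativeRing K)

CharacteristicZero : ∀ {c ℓ₁ ℓ₂} → HeytingField c ℓ₁ ℓ₂ → Set ℓ₁
CharacteristicZero K = ∀ n → ¬ (suc n · 1# ≈ 0#)
  where
  open CommutativeRing (commutativeRing K)
  open import Algebra.Definitions.RawMonoid +-rawMonoid using () renaming (_×_ to _·_)

------------------------------------------------------------------------
-- Compositions

-- 1+ n stands for the positive integer n + 1.
record ℕ⁺ : Set where
  constructor 1+_
  field pred : ℕ

Composition : Set
Composition = List ℕ⁺

value : ℕ⁺ → ℕ
value (1+ n) = suc n

_+⁺_ : ℕ⁺ → ℕ⁺ → ℕ⁺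
(1+ m) +⁺ (1+ n) = 1+ suc (m ℕ.+ n)

_≟⁺_ : DecidableEquality ℕ⁺
(1+ m) ≟⁺ (1+ n) = map′ (cong 1+_) (cong ℕ⁺.pred) (m ℕ.≟ n)

_≟ᶜ_ : DecidableEquality Composition
_≟ᶜ_ = ≡-dec _≟⁺_

open DecMembership _≟ᶜ_ using (_∈?_)

parts : Composition → List ℕ
parts = map value

size : Composition → ℕ
size I = sum (parts I)

-- The compositions obtained from I by adding up blocks of consecutive parts,
-- each listed once: J refines I if and only if I ∈ coarsenings J.
coarsenings : Composition → List Composition
coarsenings⁺ : ℕ⁺ → Composition → List Composition

coarsenings []      = [] ∷ []
coarsenings (i ∷ I) = coarsenings⁺ i I

coarsenings⁺ i []      = (i ∷ []) ∷ []
coarsenings⁺ i (j ∷ I) = map (i ∷_) (coarsenings⁺ j I) ++ coarsenings⁺ (i +⁺ j) I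

-- Every composition of n is, in exactly one way, a coarsening of (1,…,1).
compositions : ℕ → List Composition
compositions n = coarsenings (replicate n (1+ 0))

compositionsUpTo : ℕ → List Composition
compositionsUpTo n = concatMap compositions (upTo (suc n))

size-coarsenings : ∀ I {J} → J ∈ coarsenings I → size J ≡ size I
size-coarsenings⁺ : ∀ i I {J} → J ∈ coarsenings⁺ i I → size J ≡ value i ℕ.+ size I

size-coarsenings []      (here ≡.refl) = ≡.refl
size-coarsenings (i ∷ I) J∈            = size-coarsenings⁺ i I J∈

size-coarsenings⁺ i []      (here ≡.refl) = ≡.refl
size-coarsenings⁺ i (j ∷ I) J∈ with ∈-++⁻ (map (i ∷_) (coarsenings⁺ j I)) J∈
... | inj₁ J∈ˡ with J′ , J′∈ , ≡.refl ← ∈-map⁻ (i ∷_) J∈ˡ =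
  cong (value i ℕ.+_) (size-coarsenings⁺ j I J′∈)
... | inj₂ J∈ʳ = ≡.trans (size-coarsenings⁺ (i +⁺ j) I J∈ʳ) (lemma i j)
  where
  lemma : ∀ i j → value (i +⁺ j) ℕ.+ size I ≡ value i ℕ.+ (value j ℕ.+ size I)
  lemma (1+ m) (1+ n) =
    ≡.trans (cong (λ k → suc k ℕ.+ size I) (≡.sym (ℕ.+-suc m n))) (ℕ.+-assoc (suc m) (suc n) (size I))

------------------------------------------------------------------------
-- Permutations and words

-- A word of length n on the alphabet a₀ < a₁ < ⋯.
Word : ℕ → Set
Word n = Vector ℕ n

-- Permutations of n are written with the letters 0, …, n - 1.
word : ∀ {n} → Permutation′ n → Word n
word σ i = toℕ (σ ⟨$⟩ʳ i)

-- Each permutation of n letters, exactly once.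
permutations : ∀ n → List (Permutation′ n)
permutations zero    = idₚ ∷ []
permutations (suc n) =
  concatMap (λ i → map (insert Fin.zero i) (permutations n)) (allFin (suc n))

-- Std w = σ, i.e. w and σ have the same inversions.
Std_≐_ : ∀ {n} → Word n → Permutation′ n → Set
Std w ≐ σ = ∀ i j → i Fin.< j → (w j < w i) ⇔ (word σ j < word σ i)

Std?_≐_ : ∀ {n} (w : Word n) (σ : Permutation′ n) → Dec (Std w ≐ σ)
Std? w ≐ σ = Fin.all? λ i → Fin.all? λ j → (i Fin.<? j) →-dec
  ⇔-dec (w j ℕ.<? w i) (word σ j ℕ.<? word σ i)
  where
  ⇔-dec : ∀ {A B : Set} → Dec A → Dec B → Dec (A ⇔ B)
  ⇔-dec a? b? = map′ (λ (f , g) → mk⇔ f g) (λ e → Equivalence.to e , Equivalence.from e)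
    ((a? →-dec b?) ×-dec (b? →-dec a?))

-- The largest letter of w (0 when w is empty).
maxLetter : ∀ {n} → Word n → ℕ
maxLetter w = max 0 (toList w)

-- γ = uv with Std u = α, Std v = β and max v < max u.
HalfProduct : ∀ {k l} → Permutation′ k → Permutation′ l → Permutation′ (k ℕ.+ l) → Set
HalfProduct {k} α β γ = let u = take k (word γ); v = drop k (word γ) in
  Std u ≐ α × Std v ≐ β × maxLetter v < maxLetter u

halfProduct? : ∀ {k l} (α : Permutation′ k) (β : Permutation′ l) γ → Dec (HalfProduct α β γ)
halfProduct? {k} α β γ = let u = take k (word γ); v = drop k (word γ) in
  (Std? u ≐ α) ×-dec (Std? v ≐ β) ×-dec (maxLetter v ℕ.<? maxLetter u)

-- The lengths of the maximal factors of w without a descent w_i > w_{i+1}.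
-- In runsFrom k x w, a factor of length k + 1 ending with x has been read.
runsFrom : ℕ → ℕ → List ℕ → Composition
runsFrom k x []      = (1+ k) ∷ []
runsFrom k x (y ∷ w) with y ℕ.<? x
... | yes _ = (1+ k) ∷ runsFrom 0 y w
... | no  _ = runsFrom (suc k) y w

runs : List ℕ → Composition
runs []      = []
runs (x ∷ w) = runsFrom 0 x w

descentComposition : ∀ {n} → Permutation′ n → Composition
descentComposition σ = runs (toList (word σ))

------------------------------------------------------------------------
-- Exponent vectors

-- A list (e₁,…,e_r) stands for the monomial x₁^e₁ ⋯ x_r^e_r in x₁, x₂, ….
-- Its nonzero exponents, in order, form a composition.
nonzeros : List ℕ → Composition
nonzeros []          = []
nonzeros (zero ∷ e)  = nonzeros e
nonzeros (suc k ∷ e) = (1+ k) ∷ nonzeros e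

-- All ways of writing e = a + b componentwise.
splittings : List ℕ → List (List ℕ × List ℕ)
splittings []      = ([] , []) ∷ []
splittings (n ∷ e) =
  concatMap (λ k → map (λ (a , b) → (k ∷ a , (n ∸ k) ∷ b)) (splittings e)) (upTo (suc n))

size-nonzeros : ∀ e → size (nonzeros e) ≡ sum e
size-nonzeros []          = ≡.refl
size-nonzeros (zero ∷ e)  = size-nonzeros e
size-nonzeros (suc k ∷ e) = cong (suc k ℕ.+_) (size-nonzeros e)

nonzeros-parts : ∀ I → nonzeros (parts I) ≡ I
nonzeros-parts []           = ≡.refl
nonzeros-parts ((1+ k) ∷ I) = cong ((1+ k) ∷_) (nonzeros-parts I)

nonzeros-∷ : ∀ k {d e} → nonzeros d ≡ nonzeros e → nonzeros (k ∷ d) ≡ nonzeros (k ∷ e)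
nonzeros-∷ zero    eq = eq
nonzeros-∷ (suc k) eq = cong ((1+ k) ∷_) eq

sum-splittings : ∀ e → All (λ (a , b) → sum a ℕ.+ sum b ≡ sum e) (splittings e)
sum-splittings []      = ≡.refl ∷ []
sum-splittings (n ∷ e) = All.concat⁺ (All.map⁺ (All.map row (All.all-upTo (suc n))))
  where
  add : ∀ {k} → k < suc n → ∀ a b → a ℕ.+ b ≡ sum e →
        (k ℕ.+ a) ℕ.+ ((n ∸ k) ℕ.+ b) ≡ n ℕ.+ sum e
  add {k} (s≤s k≤n) a b eq = begin
    (k ℕ.+ a) ℕ.+ ((n ∸ k) ℕ.+ b)  ≡⟨ ℕ.+-assoc k a _ ⟩
    k ℕ.+ (a ℕ.+ ((n ∸ k) ℕ.+ b))  ≡⟨ cong (k ℕ.+_) (≡.sym (ℕ.+-assoc a (n ∸ k) b)) ⟩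
    k ℕ.+ ((a ℕ.+ (n ∸ k)) ℕ.+ b)  ≡⟨ cong (λ x → k ℕ.+ (x ℕ.+ b)) (ℕ.+-comm a (n ∸ k)) ⟩
    k ℕ.+ (((n ∸ k) ℕ.+ a) ℕ.+ b)  ≡⟨ cong (k ℕ.+_) (ℕ.+-assoc (n ∸ k) a b) ⟩
    k ℕ.+ ((n ∸ k) ℕ.+ (a ℕ.+ b))  ≡⟨ ≡.sym (ℕ.+-assoc k (n ∸ k) _) ⟩
    (k ℕ.+ (n ∸ k)) ℕ.+ (a ℕ.+ b)  ≡⟨ cong₂ ℕ._+_ (ℕ.m+[n∸m]≡n k≤n) eq ⟩
    n ℕ.+ sum e                    ∎
    where open ≡.≡-Reasoning
  row : ∀ {k} → k < suc n →
        All (λ (a , b) → sum a ℕ.+ sum b ≡ n ℕ.+ sum e)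
            (map (λ (a , b) → (k ∷ a , (n ∸ k) ∷ b)) (splittings e))
  row k< = All.map⁺ (All.map (λ {(a , b)} → add k< (sum a) (sum b)) (sum-splittings e))

------------------------------------------------------------------------
-- Everything below is over a fixed ring of scalars.

module Over {c ℓ} (R : CommutativeRing c ℓ) where

  open CommutativeRing R hiding (refl; sym; trans)
  module ≈ = CommutativeRing R
  open import Algebra.Definitions.RawSemiring (Semiring.rawSemiring semiring) using (_^_)

  𝟙[_] : ∀ {p} {P : Set p} → Dec P → Carrier
  𝟙[ yes _ ] = 1#
  𝟙[ no  _ ] = 0#

  ∑ : ∀ {a} {A : Set a} → List A → (A → Carrier) → Carrier
  ∑ xs f = foldr (λ x s → f x + s) 0# xs

  𝟙-no : ∀ {p} {P : Set p} (P? : Dec P) → ¬ P → 𝟙[ P? ] ≈ 0#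
  𝟙-no (yes p) ¬p = contradiction p ¬p
  𝟙-no (no _)  _  = ≈.refl

  ∑-cong : ∀ {a} {A : Set a} (xs : List A) {f g : A → Carrier} →
           (∀ x → f x ≈ g x) → ∑ xs f ≈ ∑ xs g
  ∑-cong []       f≈g = ≈.refl
  ∑-cong (x ∷ xs) f≈g = +-cong (f≈g x) (∑-cong xs f≈g)

  ∑-zero : ∀ {a} {A : Set a} {xs : List A} {f : A → Carrier} →
           All (λ x → f x ≈ 0#) xs → ∑ xs f ≈ 0#
  ∑-zero []         = ≈.refl
  ∑-zero (px ∷ pxs) = ≈.trans (+-cong px (∑-zero pxs)) (+-identityˡ 0#)

  ∑-++ : ∀ {a} {A : Set a} (xs : List A) {ys : List A} {f : A → Carrier} →
         ∑ (xs ++ ys) f ≈ ∑ xs f + ∑ ys f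
  ∑-++ []       = ≈.sym (+-identityˡ _)
  ∑-++ (x ∷ xs) = ≈.trans (+-congˡ (∑-++ xs)) (≈.sym (+-assoc _ _ _))

  ∑-map : ∀ {a b} {A : Set a} {B : Set b} (h : A → B) (xs : List A) {f : B → Carrier} →
          ∑ (map h xs) f ≈ ∑ xs (f ∘ h)
  ∑-map h []       = ≈.refl
  ∑-map h (x ∷ xs) = +-congˡ (∑-map h xs)

  ∑-concatMap : ∀ {a b} {A : Set a} {B : Set b} (h : A → List B) (xs : List A) {f : B → Carrier} →
                ∑ (concatMap h xs) f ≈ ∑ xs (λ x → ∑ (h x) f)
  ∑-concatMap h []       = ≈.refl
  ∑-concatMap h (x ∷ xs) = ≈.trans (∑-++ (h x)) (+-congˡ (∑-concatMap h xs))

  ----------------------------------------------------------------------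
  -- Free modules: formal linear combinations of basis elements, as
  -- lists of terms.  Two lists are the same element if each basis element has the same
  -- total coefficient; all maps out of Free B below depend only on these totals, up to ≈.

  Free : ∀ {b} → Set b → Set (c ⊔ b)
  Free B = List (Carrier × B)

  basis : ∀ {b} {B : Set b} → B → Free B
  basis x = (1# , x) ∷ []

  _·_ : ∀ {b} {B : Set b} → Carrier → Free B → Free B
  k · x = map (λ (k′ , y) → (k * k′ , y)) x

  linear : ∀ {a b} {A : Set a} {B : Set b} → (A → Free B) → Free A → Free B
  linear f = concatMap (λ (k , x) → k · f x)

  bilinear : ∀ {a₁ a₂ b} {A₁ : Set a₁} {A₂ : Set a₂} {B : Set b} →
             (A₁ → A₂ → Free B) → Free A₁ → Free A₂ → Free B
  bilinear f x y = linear (λ a → linear (f a) y) x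

  ----------------------------------------------------------------------
  -- FQSym, with basis G_σ

  Perm : Set
  Perm = ∃ Permutation′

  FQSym : Set c
  FQSym = Free Perm

  G : Perm → FQSym
  G = basis

  -- The half-product of two basis elements, extended by G_α ≺ 1 = G_α
  -- (used for α = 12⋯n only).
  _≺ᴳ_ : Perm → Perm → FQSym
  α       ≺ᴳ (zero  , _)       = G α
  (k , α) ≺ᴳ (l@(suc _) , β) =
    map (λ γ → (1# , k ℕ.+ l , γ)) (filter (halfProduct? α β) (permutations (k ℕ.+ l)))

  ----------------------------------------------------------------------
  -- Free Bell polynomials

  -- K⟨Y₁,Y₂,…⟩ ⊗ FQSym, with basis Y^I ⊗ G_σ
  K⟨Y⟩⊗FQSym : Set c
  K⟨Y⟩⊗FQSym = Free (Composition × Perm)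

  _≺_ : K⟨Y⟩⊗FQSym → K⟨Y⟩⊗FQSym → K⟨Y⟩⊗FQSym
  _≺_ = bilinear λ (I , α) (J , β) → linear (λ γ → basis (I ++ J , γ)) (α ≺ᴳ β)

  -- Y_m S_m
  YS : ℕ⁺ → K⟨Y⟩⊗FQSym
  YS m = basis (m ∷ [] , (value m , idₚ))

  -- bells n = (B_n, B_{n-1}, …, B_0)
  bells : ∀ n → Vec K⟨Y⟩⊗FQSym (suc n)
  bells zero    = basis ([] , (0 , idₚ)) ∷ []
  bells (suc n) =
    concatMap (λ k → YS (1+ toℕ k) ≺ Vec.lookup (bells n) k) (allFin (suc n)) ∷ bells n

  bell : ℕ → K⟨Y⟩⊗FQSym
  bell n = Vec.lookup (bells n) Fin.zero

  bell-suc : ∀ n → bell (suc n) ≡ concatMap (λ k → YS (1+ toℕ k) ≺ bell (n ∸ toℕ k)) (allFin (suc n))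
  bell-suc n = concatMap-cong (λ k → cong (YS (1+ toℕ k) ≺_) (lookup-bells n k)) (allFin (suc n))
    where
    lookup-bells : ∀ n k → Vec.lookup (bells n) k ≡ bell (n ∸ toℕ k)
    lookup-bells n       Fin.zero    = ≡.refl
    lookup-bells (suc n) (Fin.suc k) = lookup-bells n k

  coefficientOfY : Composition → K⟨Y⟩⊗FQSym → FQSym
  coefficientOfY I x =
    map (λ (k , _ , σ) → (k , σ)) (filter (λ (_ , J , _) → J ≟ᶜ I) x)

  C : Composition → FQSym
  C I = coefficientOfY I (bell (size I))

  ----------------------------------------------------------------------
  -- QSym: power series of bounded degree in x₁, x₂, … such that the coefficient
  -- of a monomial depends only on the sequence of its nonzero exponents

  record QSym : Set (c ⊔ ℓ) where
    field
      coeff          : List ℕ → Carrier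
      quasisymmetric : ∀ d e → nonzeros d ≡ nonzeros e → coeff d ≈ coeff e
      degree         : ℕ
      bounded        : ∀ e → degree < sum e → coeff e ≈ 0#

  open QSym public

  infix 4 _≋_
  _≋_ : QSym → QSym → Set ℓ
  f ≋ g = ∀ e → coeff f e ≈ coeff g e

  infixl 6 _+̂_
  infixl 7 _*̂_ _·̂_

  0̂ : QSym
  0̂ = record
    { coeff = λ _ → 0#
    ; quasisymmetric = λ _ _ _ → ≈.refl
    ; degree = 0
    ; bounded = λ _ _ → ≈.refl
    }

  _+̂_ : QSym → QSym → QSym
  f +̂ g = record
    { coeff = λ e → coeff f e + coeff g e
    ; quasisymmetric = λ d e eq → +-cong (quasisymmetric f d e eq) (quasisymmetric g d e eq)
    ; degree = degree f ℕ.⊔ degree g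
    ; bounded = λ e lt → ≈.trans
        (+-cong (bounded f e (ℕ.m⊔n<o⇒m<o _ _ lt)) (bounded g e (ℕ.m⊔n<o⇒n<o (degree f) _ lt)))
        (+-identityˡ 0#)
    }

  _·̂_ : Carrier → QSym → QSym
  k ·̂ f = record
    { coeff = λ e → k * coeff f e
    ; quasisymmetric = λ d e eq → *-congˡ (quasisymmetric f d e eq)
    ; degree = degree f
    ; bounded = λ e lt → ≈.trans (*-congˡ (bounded f e lt)) (zeroʳ k)
    }

  QuasiSymmetric : (List ℕ → Carrier) → Set ℓ
  QuasiSymmetric f = ∀ d e → nonzeros d ≡ nonzeros e → f d ≈ f e

  conv : (f g : List ℕ → Carrier) → List ℕ → Carrier
  conv f g e = ∑ (splittings e) (λ (a , b) → f a * g b)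

  conv-∷ : ∀ f g n e → conv f g (n ∷ e) ≈
           ∑ (upTo (suc n)) (λ k → conv (f ∘ (k ∷_)) (g ∘ ((n ∸ k) ∷_)) e)
  conv-∷ f g n e = ≈.trans
    (∑-concatMap (λ k → map (prepend k) (splittings e)) (upTo (suc n)) {f⊗g})
    (∑-cong (upTo (suc n)) (λ k → ∑-map (prepend k) (splittings e) {f⊗g}))
    where
    prepend : ℕ → List ℕ × List ℕ → List ℕ × List ℕ
    prepend k (a , b) = k ∷ a , (n ∸ k) ∷ b
    f⊗g : List ℕ × List ℕ → Carrier
    f⊗g (a , b) = f a * g b

  shift : ∀ {f} k → QuasiSymmetric f → QuasiSymmetric (f ∘ (k ∷_))
  shift k qf d e eq = qf (k ∷ d) (k ∷ e) (nonzeros-∷ k eq)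

  conv-nonzeros : ∀ {f g} → QuasiSymmetric f → QuasiSymmetric g →
                  ∀ e → conv f g e ≈ conv f g (parts (nonzeros e))
  conv-nonzeros qf qg [] = ≈.refl
  conv-nonzeros {f} {g} qf qg (zero ∷ e) = ≈.trans (conv-∷ f g 0 e) (≈.trans (+-identityʳ _)
    (≈.trans (∑-cong (splittings e) (λ (a , b) → *-cong (qf (0 ∷ a) a ≡.refl) (qg (0 ∷ b) b ≡.refl)))
             (conv-nonzeros qf qg e)))
  conv-nonzeros {f} {g} qf qg (suc n ∷ e) = ≈.trans (conv-∷ f g (suc n) e) (≈.trans
    (∑-cong (upTo (suc (suc n))) (λ k → conv-nonzeros (shift k qf) (shift (suc n ∸ k) qg) e))
    (≈.sym (conv-∷ f g (suc n) (parts (nonzeros e)))))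

  _*̂_ : QSym → QSym → QSym
  f *̂ g = record
    { coeff = λ e → ∑ (splittings e) (λ (a , b) → coeff f a * coeff g b)
    ; quasisymmetric = λ d e eq → ≈.trans (reduce d)
        (≈.trans (reflexive (cong (conv (coeff f) (coeff g) ∘ parts) eq)) (≈.sym (reduce e)))
    ; degree = degree f ℕ.+ degree g
    ; bounded = λ e lt → ∑-zero (All.map (λ {(a , b)} eq →
        vanish a b (≡.subst (degree f ℕ.+ degree g <_) (≡.sym eq) lt)) (sum-splittings e))
    }
    where
    reduce = conv-nonzeros (quasisymmetric f) (quasisymmetric g)
    vanish : ∀ a b → degree f ℕ.+ degree g < sum a ℕ.+ sum b → coeff f a * coeff g b ≈ 0#
    vanish a b lt with degree f ℕ.<? sum a
    ... | yes p = ≈.trans (*-congʳ (bounded f a p)) (zeroˡ _)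
    ... | no ¬p = ≈.trans (*-congˡ (bounded g b
      (ℕ.≰⇒> λ q → ℕ.<⇒≱ lt (ℕ.+-mono-≤ (ℕ.≮⇒≥ ¬p) q)))) (zeroʳ _)

  -- The linear map sending a basis element x to f x
  linearQ : ∀ {b} {B : Set b} → (B → QSym) → Free B → QSym
  linearQ f = foldr (λ (k , x) s → k ·̂ f x +̂ s) 0̂

  M : Composition → QSym
  M I = record
    { coeff = λ e → 𝟙[ nonzeros e ≟ᶜ I ]
    ; quasisymmetric = λ _ _ eq → reflexive (cong (λ J → 𝟙[ J ≟ᶜ I ]) eq)
    ; degree = size I
    ; bounded = λ e lt → 𝟙-no (nonzeros e ≟ᶜ I)
        λ { ≡.refl → ℕ.<-irrefl (size-nonzeros e) lt }
    }

  -- The sum of the M J for J refining I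
  F : Composition → QSym
  F I = record
    { coeff = λ e → 𝟙[ I ∈? coarsenings (nonzeros e) ]
    ; quasisymmetric = λ _ _ eq → reflexive (cong (λ J → 𝟙[ I ∈? coarsenings J ]) eq)
    ; degree = size I
    ; bounded = λ e lt → 𝟙-no (I ∈? coarsenings (nonzeros e))
        λ I∈ → ℕ.<-irrefl (≡.trans (size-coarsenings (nonzeros e) I∈) (size-nonzeros e)) lt
    }

  commutativeImage : FQSym → QSym
  commutativeImage = linearQ (λ (_ , σ) → F (descentComposition (flip σ)))

  ----------------------------------------------------------------------
  -- Sym, with basis S^I

  Sym : Set c
  Sym = Free Composition

  _*ˢ_ : Sym → Sym → Sym
  _*ˢ_ = bilinear (λ I J → basis (I ++ J))

  S : ℤ → Sym
  S (+ zero)  = basis []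
  S (+ suc n) = basis ((1+ n) ∷ [])
  S -[1+ n ]  = []

  ribbon : Composition → Sym
  ribbon I = map (λ J → ((- 1#) ^ (length I ∸ length J) , J)) (coarsenings I)

  -- The pairing with ⟨S^I, M_J⟩ = δ_IJ: pairing with S^I is extracting the coefficient of M_I.
  ⟨_,_⟩ : Sym → QSym → Carrier
  ⟨ H , f ⟩ = ∑ H (λ (k , I) → k * coeff f (parts I))

  ----------------------------------------------------------------------
  -- The bar involution

  -- As ⟨R_I, F_J⟩ = δ_IJ, the coefficient of F_I in f is ⟨R_I, f⟩.
  F-expansion : QSym → Free Composition
  F-expansion f = map (λ I → (⟨ ribbon I , f ⟩ , I)) (compositionsUpTo (degree f))

  bar : QSym → QSym
  bar f = linearQ (λ I → F (reverse I)) (F-expansion f)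

  ----------------------------------------------------------------------
  -- Immaculate functions

  -- The adjoint of multiplication by f.  Since (S^J) and (M_J) are dual, the coefficient
  -- of S^J in f^⊥ S^I is ⟨S^I, f M_J⟩, and this vanishes for |J| > |I|.
  _⊥ : QSym → Sym → Sym
  f ⊥ = linear λ I → map (λ J → (⟨ basis I , f *̂ M J ⟩ , J)) (compositionsUpTo (size I))

  -- On S^I the sum over all i ≥ 0 stops at |I|, for degree reasons.
  𝔹 : ℤ → Sym → Sym
  𝔹 m = linear λ I → concatMap
    (λ i → ((- 1#) ^ i) · (S (m ℤ.+ + i) *ˢ (F (replicate i (1+ 0)) ⊥) (basis I)))
    (upTo (suc (size I)))

  𝔖 : Composition → Sym
  𝔖 = foldr (λ i H → 𝔹 (+ value i) H) (basis [])

  IsDualImmaculate : (Composition → QSym) → Set ℓ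
  IsDualImmaculate D = ∀ I J → ⟨ 𝔖 I , D J ⟩ ≈ 𝟙[ I ≟ᶜ J ]

{-# OPTIONS --safe #-}

-- Write f_a for the coefficient of x₁^a in a quasi-symmetric function f, a series in x₂, x₃, ….
-- The transpose of 𝔹_m is f ↦ 𝔹ᵀ_m f = ∑ (-1)^i e_i f_{m+i}.  A word of C_{(j,J)} is uv with u weakly
-- increasing of length j, v a word of C_J and max v < max u, so in its commutative image P_{(j,J)}
-- the coefficient of the m-th power of the last variable, m ≥ 1, is h_{j-m} P_J.  The bar involution
-- reverses the order of the variables; hence D_{(j,J)} = bar P_{(j,J)} satisfies
-- (D_{(j,J)})_m = h_{j-m} D_J, and ∑ (-1)^i e_i h_{n-i} = [n = 0] gives 𝔹ᵀ_m D_{(j,J)} = [m = j] D_J,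
-- which is duality with 𝔖_{(m,I)} = 𝔹_m 𝔖_I.  Uniqueness holds because 𝔹ᵀ_m f = 0 for all m ≥ 1
-- forces f_m = 0 for all m ≥ 1, by induction on the degree in the remaining variables.

module Submission where

open import Defs
open import Algebra.Apartness.Bundles using (HeytingField)
open import Algebra.Bundles using (CommutativeRing; Semiring)
open import Data.Bool.Base using (Bool; true; false; T)
open import Data.Fin.Base as Fin using (Fin; toℕ; _↑ˡ_; _↑ʳ_)
open import Data.Fin.Permutation using (Permutation′; _⟨$⟩ʳ_; _⟨$⟩ˡ_; flip; insert; inverseˡ; inverseʳ; insert-punchIn)
  renaming (id to idₚ)
import Data.Fin.Properties as Fin
import Data.Integer.Base as ℤ
open import Data.List.Base hiding (sum; find; merge)
open import Data.List.Extrema.Nat using (argmax-sel; max[xs]<max[ys]⁺; xs≤max)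
import Data.List.Membership.DecPropositional as DecMembership
open import Data.List.Membership.Propositional using (_∈_; lose; find)
open import Data.List.Membership.Propositional.Properties
open import Data.List.Membership.Propositional.Properties.WithK using (unique∧set⇒bag)
open import Data.List.Properties using
  ( ∷-injective; ∷-injectiveˡ; ∷-injectiveʳ; ++-assoc; ++-identityʳ; length-++; length-map; length-tabulate
  ; map-++; map-∘; map-cong; map-tabulate; map-upTo; reverse-involutive; tabulate-cong; unfold-reverse)
open import Data.List.Relation.Binary.BagAndSetEquality using (∼bag⇒↭)
open import Data.List.Relation.Binary.Disjoint.Propositional using (Disjoint)
open import Data.List.Relation.Binary.Permutation.Propositional as Perm
  using (_↭_; prep; ↭-refl; ↭-sym; ↭-trans; ↭-reflexive)
import Data.List.Relation.Binary.Permutation.Propositional.Properties as ↭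
open import Data.List.Relation.Unary.All as All using (All; []; _∷_)
import Data.List.Relation.Unary.All.Properties as All
open import Data.List.Relation.Unary.AllPairs as AllPairs using (AllPairs; []; _∷_)
import Data.List.Relation.Unary.AllPairs.Properties as AllPairs
open import Data.List.Relation.Unary.Any as Any using (Any; here; there)
open import Data.List.Relation.Unary.Unique.Propositional using (Unique)
import Data.List.Relation.Unary.Unique.Propositional.Properties as Unique
open import Data.Nat.Base as ℕ using (ℕ; zero; suc; _∸_; _<_; _≤_; z≤n; s≤s)
open import Data.Nat.ListAction using (sum)
open import Data.Nat.ListAction.Properties using (sum-↭)
import Data.Nat.Properties as ℕ
open import Data.Product.Base using (∃; ∃₂; _×_; _,_; proj₁; proj₂)
open import Data.Sum.Base using (inj₁; inj₂)
open import Data.Unit.Base using (tt)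
open import Function.Base using (_∘_; id)
open import Function.Bundles using (Equivalence; mk⇔)
open import Relation.Binary.Definitions using (tri<; tri≈; tri>)
open import Relation.Binary.PropositionalEquality as ≡ using (_≡_; _≢_; cong; subst)
open import Relation.Nullary.Decidable using (Dec; yes; no)
open import Relation.Nullary.Negation using (¬_; contradiction)

-- Here `FQSym` consists of formal combinations of permutations rather than series in words, and the
-- commutative image reads the descents of inverse permutations, so the argument on words is
-- transported to inverses. For γ in the half-product of α and β, the word of the inverse of γ is a
-- shuffle of the inverse of α with the shifted inverse of β, and `max v < max u` says that the
-- shuffle ends with the last letter of the first word. The coefficient of a monomial in
-- `F (runs p)` tests whether `p` splits into ascending factors of prescribed lengths. The product
-- of a complete function with P_J thus becomes a count of shuffles: an ascending last factor of
-- length m that ends with the last letter of 12⋯j contains no letter of the other word, since those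
-- are all larger. It uses up the last m letters of 12⋯j, and the remaining j - m are shuffled
-- freely.

module Combinatorics where

  open import Data.Nat.Base using (_+_)
  open import Data.Nat.Properties using
    ( +-assoc; +-suc; +-comm; +-identityʳ; ≤-refl; ≤-trans; ≤-reflexive; ≤-pred; <-irrefl; <-asym; <-cmp; ≤-<-trans
    ; m≤m+n; m≤n⇒m≤1+n; m+n≮m; <⇒≤; _<?_)
  open import Relation.Binary.PropositionalEquality using (refl; sym; trans; cong₂; subst₂)

  -- Compositions and their coarsenings

  +⁺-assoc : ∀ i j k → (i +⁺ j) +⁺ k ≡ i +⁺ (j +⁺ k)
  +⁺-assoc (1+ i) (1+ j) (1+ k) =
    cong (1+_ ∘ suc) (trans (cong suc (+-assoc i j k)) (sym (+-suc i (j + k))))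

  +⁺-comm : ∀ i j → i +⁺ j ≡ j +⁺ i
  +⁺-comm (1+ i) (1+ j) = cong (1+_ ∘ suc) (+-comm i j)

  -- The lower bound on the first part separates the two halves of `coarsenings⁺`: compositions that
  -- keep `i` begin with `i`, those that merge it begin with a larger part. Many impossible cases
  -- below are excluded in this way.
  coarsenings-head : ∀ i I {J} → J ∈ coarsenings⁺ i I →
                     ∃₂ λ h T → J ≡ h ∷ T × value i ≤ value h
  coarsenings-head i [] (here refl) = i , [] , refl , ≤-refl
  coarsenings-head i (j ∷ I) J∈ with ∈-++⁻ (map (i ∷_) (coarsenings⁺ j I)) J∈
  ... | inj₁ J∈ˡ with T , _ , refl ← ∈-map⁻ (i ∷_) J∈ˡ = i , T , refl , ≤-refl
  ... | inj₂ J∈ʳ with h , T , refl , le ← coarsenings-head (i +⁺ j) I J∈ʳ =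
    h , T , refl , ≤-trans (s≤s (m≤n⇒m≤1+n (m≤m+n _ _))) le

  coarsenings⁺-unique : ∀ i I → Unique (coarsenings⁺ i I)
  coarsenings⁺-unique i [] = [] ∷ []
  coarsenings⁺-unique i (j ∷ I) =
    Unique.++⁺ (Unique.map⁺ (λ { refl → refl }) (coarsenings⁺-unique j I))
               (coarsenings⁺-unique (i +⁺ j) I) disjoint
    where
    disjoint : Disjoint (map (i ∷_) (coarsenings⁺ j I)) (coarsenings⁺ (i +⁺ j) I)
    disjoint (J∈ˡ , J∈ʳ) with T , _ , refl ← ∈-map⁻ (i ∷_) J∈ˡ
                         with h , _ , refl , le ← coarsenings-head (i +⁺ j) I J∈ʳ =
      <-irrefl refl (≤-trans (s≤s (s≤s (m≤m+n _ _))) le)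

  coarsenings-unique : ∀ I → Unique (coarsenings I)
  coarsenings-unique []      = [] ∷ []
  coarsenings-unique (i ∷ I) = coarsenings⁺-unique i I

  ∷-∈-coarsenings : ∀ i I {J} → J ∈ coarsenings I → i ∷ J ∈ coarsenings⁺ i I
  ∷-∈-coarsenings i []      (here refl) = here refl
  ∷-∈-coarsenings i (j ∷ I) J∈          = ∈-++⁺ˡ (∈-map⁺ (i ∷_) J∈)

  ++-∈-coarsenings : ∀ I K {J L} → J ∈ coarsenings I → L ∈ coarsenings K →
                     J ++ L ∈ coarsenings (I ++ K)
  ++-∈-coarsenings⁺ : ∀ i I K {J L} → J ∈ coarsenings⁺ i I → L ∈ coarsenings K →
                      J ++ L ∈ coarsenings⁺ i (I ++ K)
  ++-∈-coarsenings []      K (here refl) L∈ = L∈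
  ++-∈-coarsenings (i ∷ I) K J∈          L∈ = ++-∈-coarsenings⁺ i I K J∈ L∈
  ++-∈-coarsenings⁺ i []      K (here refl) L∈ = ∷-∈-coarsenings i K L∈
  ++-∈-coarsenings⁺ i (j ∷ I) K J∈          L∈ with ∈-++⁻ (map (i ∷_) (coarsenings⁺ j I)) J∈
  ... | inj₁ J∈ˡ with T , T∈ , refl ← ∈-map⁻ (i ∷_) J∈ˡ =
    ∈-++⁺ˡ (∈-map⁺ (i ∷_) (++-∈-coarsenings⁺ j I K T∈ L∈))
  ... | inj₂ J∈ʳ = ∈-++⁺ʳ _ (++-∈-coarsenings⁺ (i +⁺ j) I K J∈ʳ L∈)

  -- Reversal turns merging at the front, by which `coarsenings` recurses, into merging at the back;
  -- this supplies the latter.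
  split-last : ∀ I j k {J} → J ∈ coarsenings (I ++ (j +⁺ k) ∷ []) → J ∈ coarsenings (I ++ j ∷ k ∷ [])
  split-last⁺ : ∀ i I j k {J} → J ∈ coarsenings⁺ i (I ++ (j +⁺ k) ∷ []) →
                J ∈ coarsenings⁺ i (I ++ j ∷ k ∷ [])
  split-last []      j k J∈ = there J∈
  split-last (i ∷ I) j k J∈ = split-last⁺ i I j k J∈
  split-last⁺ i []      j k (here refl)         = there (here refl)
  split-last⁺ i []      j k (there (here refl)) =
    there (there (there (here (cong (_∷ []) (sym (+⁺-assoc i j k))))))
  split-last⁺ i (h ∷ I) j k J∈ with ∈-++⁻ (map (i ∷_) (coarsenings⁺ h (I ++ (j +⁺ k) ∷ []))) J∈
  ... | inj₁ J∈ˡ with T , T∈ , refl ← ∈-map⁻ (i ∷_) J∈ˡ =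
    ∈-++⁺ˡ (∈-map⁺ (i ∷_) (split-last⁺ h I j k T∈))
  ... | inj₂ J∈ʳ = ∈-++⁺ʳ _ (split-last⁺ (i +⁺ h) I j k J∈ʳ)

  reverse-∈-coarsenings : ∀ I {J} → J ∈ coarsenings I → reverse J ∈ coarsenings (reverse I)
  reverse-∈-coarsenings⁺ : ∀ i I {J} → J ∈ coarsenings⁺ i I → reverse J ∈ coarsenings (reverse (i ∷ I))
  reverse-∈-coarsenings []      (here refl) = here refl
  reverse-∈-coarsenings (i ∷ I) J∈          = reverse-∈-coarsenings⁺ i I J∈
  reverse-∈-coarsenings⁺ i [] (here refl) = here refl
  reverse-∈-coarsenings⁺ i (j ∷ I) J∈ with ∈-++⁻ (map (i ∷_) (coarsenings⁺ j I)) J∈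
  ... | inj₁ J∈ˡ with T , T∈ , refl ← ∈-map⁻ (i ∷_) J∈ˡ =
    subst₂ (λ K L → K ∈ coarsenings L) (sym (unfold-reverse i T)) (sym (unfold-reverse i (j ∷ I)))
      (++-∈-coarsenings (reverse (j ∷ I)) (i ∷ []) (reverse-∈-coarsenings⁺ j I T∈) (here refl))
  ... | inj₂ J∈ʳ = subst (λ K → _ ∈ coarsenings K) rev-rev
      (split-last (reverse I) j i (subst (λ K → _ ∈ coarsenings K)
        (trans (unfold-reverse (i +⁺ j) I) (cong (λ k → reverse I ++ k ∷ []) (+⁺-comm i j)))
        (reverse-∈-coarsenings⁺ (i +⁺ j) I J∈ʳ)))
    where
    rev-rev : reverse I ++ j ∷ i ∷ [] ≡ reverse (i ∷ j ∷ I)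
    rev-rev = sym (trans (unfold-reverse i (j ∷ I))
      (trans (cong (_++ i ∷ []) (unfold-reverse j I)) (++-assoc (reverse I) _ _)))

  -- Compositions with all parts 1, and the list of compositions of bounded size

  size-replicate : ∀ n → size (replicate n (1+ 0)) ≡ n
  size-replicate zero    = refl
  size-replicate (suc n) = cong suc (size-replicate n)

  -- A composition with all parts 1 admits no proper refinement. Hence its `F` is a single `M`, an
  -- elementary function.
  replicate-∈-coarsenings : ∀ i I → replicate i (1+ 0) ∈ coarsenings I → I ≡ replicate i (1+ 0)
  replicate-∈-coarsenings⁺ : ∀ i j I → replicate i (1+ 0) ∈ coarsenings⁺ j I → j ∷ I ≡ replicate i (1+ 0)
  replicate-∈-coarsenings i [] (here eq) = sym eq
  replicate-∈-coarsenings i (j ∷ I) J∈   = replicate-∈-coarsenings⁺ i j I J∈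
  replicate-∈-coarsenings⁺ i j [] (here eq) = sym eq
  replicate-∈-coarsenings⁺ zero j (k ∷ I) J∈ with _ , _ , () , _ ← coarsenings-head j (k ∷ I) J∈
  replicate-∈-coarsenings⁺ (suc i) j (k ∷ I) J∈ with ∈-++⁻ (map (j ∷_) (coarsenings⁺ k I)) J∈
  ... | inj₁ J∈ˡ with T , T∈ , refl ← ∈-map⁻ (j ∷_) J∈ˡ =
    cong (j ∷_) (replicate-∈-coarsenings⁺ i k I T∈)
  ... | inj₂ J∈ʳ with h , T , refl , s≤s () ← coarsenings-head (j +⁺ k) I J∈ʳ

  self-∈-coarsenings : ∀ I → I ∈ coarsenings I
  self-∈-coarsenings []      = here refl
  self-∈-coarsenings (i ∷ I) = ∷-∈-coarsenings i I (self-∈-coarsenings I)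

  -- The invariant of the accumulator: besides the initial one, `a` ones have been merged into the
  -- first part and `b` are still to be merged.
  ∈-coarsenings-ones : ∀ a b s {K} → K ∈ coarsenings (replicate s (1+ 0)) →
                       (1+ (a + b)) ∷ K ∈ coarsenings⁺ (1+ a) (replicate (b + s) (1+ 0))
  ∈-coarsenings-ones a zero    s K∈ rewrite +-identityʳ a = ∷-∈-coarsenings (1+ a) (replicate s (1+ 0)) K∈
  ∈-coarsenings-ones a (suc b) s {K} K∈ = ∈-++⁺ʳ (map _ (coarsenings⁺ (1+ 0) (replicate (b + s) (1+ 0))))
    (subst₂ (λ k l → (1+ k) ∷ K ∈ coarsenings⁺ (1+ l) (replicate (b + s) (1+ 0)))
      (sym (+-suc a b)) (cong suc (sym (+-identityʳ a))) (∈-coarsenings-ones (suc a) b s K∈))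

  ∈-compositions : ∀ K → K ∈ compositions (size K)
  ∈-compositions []           = here refl
  ∈-compositions ((1+ k) ∷ K) = ∈-coarsenings-ones 0 k (size K) (∈-compositions K)

  size-compositions : ∀ n {K} → K ∈ compositions n → size K ≡ n
  size-compositions n K∈ = trans (size-coarsenings (replicate n (1+ 0)) K∈) (size-replicate n)

  ∈-compositionsUpTo : ∀ n {K} → size K ≤ n → K ∈ compositionsUpTo n
  ∈-compositionsUpTo n {K} le =
    ∈-concat⁺′ (∈-compositions K) (∈-map⁺ compositions (∈-upTo⁺ (s≤s le)))

  size-compositionsUpTo : ∀ n {K} → K ∈ compositionsUpTo n → size K ≤ n
  size-compositionsUpTo n K∈ with _ , K∈′ , L∈ ← ∈-concat⁻′ (map compositions (upTo (suc n))) K∈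
                             with m , m∈ , refl ← ∈-map⁻ compositions L∈ =
    ≤-trans (≤-reflexive (size-compositions m K∈′)) (≤-pred (∈-upTo⁻ m∈))

  compositionsUpTo-unique : ∀ n → Unique (compositionsUpTo n)
  compositionsUpTo-unique n = Unique.concat⁺
    (All.map⁺ (All.universal (λ m → coarsenings-unique (replicate m (1+ 0))) (upTo (suc n))))
    (AllPairs.map⁺ (AllPairs.map
      (λ { m≢k {_} (∈m , ∈k) → m≢k (trans (sym (size-compositions _ ∈m)) (size-compositions _ ∈k)) })
      (Unique.upTo⁺ (suc n))))

  reverse-nonzeros : ∀ e → nonzeros (reverse e) ≡ reverse (nonzeros e)
  reverse-nonzeros [] = refl
  reverse-nonzeros (k ∷ e) = trans (cong nonzeros (unfold-reverse k e)) (trans (append (reverse e) k)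
      (trans (cong (_++ nonzeros (k ∷ [])) (reverse-nonzeros e)) (reversed k)))
    where
    append : ∀ e k → nonzeros (e ++ k ∷ []) ≡ nonzeros e ++ nonzeros (k ∷ [])
    append []          k = refl
    append (zero ∷ e)  k = append e k
    append (suc n ∷ e) k = cong ((1+ n) ∷_) (append e k)
    reversed : ∀ k → reverse (nonzeros e) ++ nonzeros (k ∷ []) ≡ reverse (nonzeros (k ∷ e))
    reversed zero    = ++-identityʳ _
    reversed (suc k) = sym (unfold-reverse (1+ k) (nonzeros e))

  -- Shuffles

  -- The shuffles of xs and ys that end with the last letter of xs.
  shuffles : ∀ {a} {A : Set a} → List A → List A → List (List A)
  shuffles []       []       = [] ∷ []
  shuffles []       (_ ∷ _)  = []
  shuffles (x ∷ xs) []       = map (x ∷_) (shuffles xs [])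
  shuffles (x ∷ xs) (y ∷ ys) = map (x ∷_) (shuffles xs (y ∷ ys)) ++ map (y ∷_) (shuffles (x ∷ xs) ys)

  shuffles-map : ∀ {a b} {A : Set a} {B : Set b} (f : A → B) xs ys →
                 shuffles (map f xs) (map f ys) ≡ map (map f) (shuffles xs ys)
  shuffles-map {A = A} f = go
    where
    map-∷ : ∀ x zss → map (f x ∷_) (map (map f) zss) ≡ map (map f) (map (x ∷_) zss)
    map-∷ x zss = trans (sym (map-∘ zss)) (map-∘ zss)
    go : ∀ (xs ys : List A) → shuffles (map f xs) (map f ys) ≡ map (map f) (shuffles xs ys)
    go []       []       = refl
    go []       (_ ∷ _)  = refl
    go (x ∷ xs) []       = trans (cong (map (f x ∷_)) (go xs [])) (map-∷ x (shuffles xs []))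
    go (x ∷ xs) (y ∷ ys) = trans
      (cong₂ (λ us vs → map (f x ∷_) us ++ map (f y ∷_) vs) (go xs (y ∷ ys)) (go (x ∷ xs) ys))
      (trans (cong₂ _++_ (map-∷ x (shuffles xs (y ∷ ys))) (map-∷ y (shuffles (x ∷ xs) ys)))
        (sym (map-++ (map f) (map (x ∷_) (shuffles xs (y ∷ ys))) _)))

  module _ {a} {A : Set a} where

    shuffles-↭ : ∀ (xs ys : List A) {zs} → zs ∈ shuffles xs ys → zs ↭ xs ++ ys
    shuffles-↭ []       []       (here refl) = ↭-refl
    shuffles-↭ (x ∷ xs) []       zs∈ with zs′ , zs′∈ , refl ← ∈-map⁻ (x ∷_) zs∈ =
      prep x (shuffles-↭ xs [] zs′∈)
    shuffles-↭ (x ∷ xs) (y ∷ ys) zs∈ with ∈-++⁻ (map (x ∷_) (shuffles xs (y ∷ ys))) zs∈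
    ... | inj₁ zs∈ˡ with zs′ , zs′∈ , refl ← ∈-map⁻ (x ∷_) zs∈ˡ = prep x (shuffles-↭ xs (y ∷ ys) zs′∈)
    ... | inj₂ zs∈ʳ with zs′ , zs′∈ , refl ← ∈-map⁻ (y ∷_) zs∈ʳ =
      ↭-trans (prep y (shuffles-↭ (x ∷ xs) ys zs′∈)) (↭-sym (↭.shift y (x ∷ xs) ys))

    shuffles-unique : ∀ (xs ys : List A) → All (λ x → All (x ≢_) ys) xs → Unique (shuffles xs ys)
    shuffles-unique []       []       _          = [] ∷ []
    shuffles-unique []       (_ ∷ _)  _          = []
    shuffles-unique (x ∷ xs) []       (_ ∷ xs≢)  = Unique.map⁺ ∷-injectiveʳ (shuffles-unique xs [] xs≢)
    shuffles-unique (x ∷ xs) (y ∷ ys) ((x≢y ∷ x≢ys) ∷ xs≢) = Unique.++⁺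
      (Unique.map⁺ ∷-injectiveʳ (shuffles-unique xs (y ∷ ys) xs≢))
      (Unique.map⁺ ∷-injectiveʳ (shuffles-unique (x ∷ xs) ys (x≢ys ∷ All.map All.tail xs≢)))
      disjoint
      where
      disjoint : Disjoint (map (x ∷_) (shuffles xs (y ∷ ys))) (map (y ∷_) (shuffles (x ∷ xs) ys))
      disjoint (∈ˡ , ∈ʳ) with _ , _ , refl ← ∈-map⁻ (x ∷_) ∈ˡ with _ , _ , eq ← ∈-map⁻ (y ∷_) ∈ʳ =
        x≢y (∷-injectiveˡ eq)

    module _ {r} {_⊏_ : A → A → Set r} where

      -- For nonempty `ys` this plays the role of `max v < max u`, in a form without maxima that is
      -- passed on letter by letter along a shuffle.
      Dominated : List A → List A → Set _
      Dominated xs ys = All (λ y → Any (y ⊏_) xs) ys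

      shuffle⇒sorted : ∀ xs ys {zs} → zs ∈ shuffles xs ys → AllPairs _⊏_ zs →
                       AllPairs _⊏_ xs × AllPairs _⊏_ ys × Dominated xs ys
      shuffle⇒sorted []       []       _   _ = [] , [] , []
      shuffle⇒sorted (x ∷ xs) []       zs∈ s with zs′ , zs′∈ , refl ← ∈-map⁻ (x ∷_) zs∈
                                            with z⊏ ∷ s′ ← s
                                            with xs↗ , ys↗ , d ← shuffle⇒sorted xs [] zs′∈ s′ =
        All.++⁻ˡ xs (↭.All-resp-↭ (shuffles-↭ xs [] zs′∈) z⊏) ∷ xs↗ , ys↗ , []
      shuffle⇒sorted (x ∷ xs) (y ∷ ys) zs∈ s with ∈-++⁻ (map (x ∷_) (shuffles xs (y ∷ ys))) zs∈
      ... | inj₁ zs∈ˡ with zs′ , zs′∈ , refl ← ∈-map⁻ (x ∷_) zs∈ˡ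
                      with z⊏ ∷ s′ ← s
                      with xs↗ , ys↗ , d ← shuffle⇒sorted xs (y ∷ ys) zs′∈ s′ =
        All.++⁻ˡ xs (↭.All-resp-↭ (shuffles-↭ xs (y ∷ ys) zs′∈) z⊏) ∷ xs↗ , ys↗ , All.map there d
      ... | inj₂ zs∈ʳ with zs′ , zs′∈ , refl ← ∈-map⁻ (y ∷_) zs∈ʳ
                      with z⊏ ∷ s′ ← s
                      with xs↗ , ys↗ , d ← shuffle⇒sorted (x ∷ xs) ys zs′∈ s′
                      with z⊏x ∷ z⊏′ ← ↭.All-resp-↭ (shuffles-↭ (x ∷ xs) ys zs′∈) z⊏ =
        xs↗ , All.++⁻ʳ xs z⊏′ ∷ ys↗ , here z⊏x ∷ d

      -- The head of `zs` is its least letter, hence the head of `xs` or of `ys`. The list `xs`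
      -- cannot run out before `ys`, since nothing would dominate the letters of `ys` left over.
      sorted⇒shuffle : (∀ {x y} → x ⊏ y → ¬ y ⊏ x) → ∀ zs xs ys → zs ↭ xs ++ ys → AllPairs _⊏_ zs →
                       AllPairs _⊏_ xs → AllPairs _⊏_ ys → Dominated xs ys → zs ∈ shuffles xs ys
      sorted⇒shuffle asym [] []       []       _ _ _ _ _ = here refl
      sorted⇒shuffle asym [] []       (y ∷ ys) p = contradiction (↭-sym p) ↭.¬x∷xs↭[]
      sorted⇒shuffle asym [] (x ∷ xs) ys       p = contradiction (↭-sym p) ↭.¬x∷xs↭[]
      sorted⇒shuffle asym (z ∷ zs) [] [] p = contradiction p ↭.¬x∷xs↭[]
      sorted⇒shuffle asym (z ∷ zs) [] (y ∷ ys) _ _ _ _ (() ∷ _)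
      sorted⇒shuffle asym (z ∷ zs) (x ∷ xs) ys p (z⊏ ∷ s) (x⊏ ∷ xs↗) ys↗ d =
        first ys p ys↗ d
        where
        least : ∀ {w} → w ∈ z ∷ zs → ¬ w ⊏ z
        least (here refl) w⊏z = asym w⊏z w⊏z
        least (there w∈)  w⊏z = asym w⊏z (All.lookup z⊏ w∈)
        x∷ : ∀ ys → z ≡ x → z ∷ zs ↭ x ∷ xs ++ ys → AllPairs _⊏_ ys → Dominated (x ∷ xs) ys →
             zs ∈ shuffles xs ys
        x∷ ys refl p ys↗ d = sorted⇒shuffle asym zs xs ys (↭.drop-∷ p) s xs↗ ys↗ (All.tabulate later)
          where
          -- Removing `x` from `xs` keeps domination: `x` is the least letter and lies above no
          -- letter of `ys`.
          later : ∀ {y} → y ∈ ys → Any (y ⊏_) xs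
          later y∈ with All.lookup d y∈
          ... | here y⊏x = contradiction y⊏x (least (↭.∈-resp-↭ (↭-sym p) (there (∈-++⁺ʳ xs y∈))))
          ... | there y⊏ = y⊏
        first : ∀ ys → z ∷ zs ↭ x ∷ xs ++ ys → AllPairs _⊏_ ys → Dominated (x ∷ xs) ys →
                z ∷ zs ∈ shuffles (x ∷ xs) ys
        first [] p ys↗ d with ∈-++⁻ (x ∷ xs) (↭.∈-resp-↭ p (here refl))
        ... | inj₁ (here refl) = ∈-map⁺ (x ∷_) (x∷ [] refl p ys↗ d)
        ... | inj₁ (there z∈)  =
          contradiction (All.lookup x⊏ z∈) (least (↭.∈-resp-↭ (↭-sym p) (here refl)))
        first (y ∷ ys) p (y⊏ ∷ ys↗) (y-dom ∷ d) with ∈-++⁻ (x ∷ xs) (↭.∈-resp-↭ p (here refl))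
        ... | inj₁ (here refl) = ∈-++⁺ˡ (∈-map⁺ (x ∷_) (x∷ (y ∷ ys) refl p (y⊏ ∷ ys↗) (y-dom ∷ d)))
        ... | inj₁ (there z∈)  =
          contradiction (All.lookup x⊏ z∈) (least (↭.∈-resp-↭ (↭-sym p) (here refl)))
        ... | inj₂ (here refl) = ∈-++⁺ʳ (map (x ∷_) (shuffles xs (y ∷ ys))) (∈-map⁺ (y ∷_)
          (sorted⇒shuffle asym zs (x ∷ xs) ys (↭.drop-mid [] (x ∷ xs) p) s (x⊏ ∷ xs↗) ys↗ d))
        ... | inj₂ (there z∈)  =
          contradiction (All.lookup y⊏ z∈) (least (↭.∈-resp-↭ (↭-sym p) (∈-++⁺ʳ (x ∷ xs) (here refl))))

  -- Permutations as lists of positions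

  -- The word of the inverse of `σ`: the image of `G σ` is read off the descents of this list, and
  -- half-products become shuffles of such lists.
  positions : ∀ {n} → Permutation′ n → List (Fin n)
  positions σ = tabulate (σ ⟨$⟩ˡ_)

  module _ {n} (σ : Permutation′ n) where

    ʳ-injective : ∀ {i j} → σ ⟨$⟩ʳ i ≡ σ ⟨$⟩ʳ j → i ≡ j
    ʳ-injective eq = trans (sym (inverseˡ σ)) (trans (cong (σ ⟨$⟩ˡ_) eq) (inverseˡ σ))

    ˡ-injective : ∀ {i j} → σ ⟨$⟩ˡ i ≡ σ ⟨$⟩ˡ j → i ≡ j
    ˡ-injective eq = trans (sym (inverseʳ σ)) (trans (cong (σ ⟨$⟩ʳ_) eq) (inverseʳ σ))

    positions-unique : Unique (positions σ)
    positions-unique = Unique.tabulate⁺ ˡ-injective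

    ∈-positions : ∀ i → i ∈ positions σ
    ∈-positions i = subst (_∈ positions σ) (inverseˡ σ) (∈-tabulate⁺ (σ ⟨$⟩ʳ i))

  unique∧set⇒↭ : ∀ {a} {A : Set a} {xs ys : List A} → Unique xs → Unique ys →
                 (∀ {x} → x ∈ xs → x ∈ ys) → (∀ {x} → x ∈ ys → x ∈ xs) → xs ↭ ys
  unique∧set⇒↭ xs! ys! to from = ∼bag⇒↭ (unique∧set⇒bag xs! ys! (mk⇔ to from))

  tabulate-injective : ∀ {a} {A : Set a} {n} (f g : Fin n → A) → tabulate f ≡ tabulate g → ∀ i → f i ≡ g i
  tabulate-injective f g eq Fin.zero    = ∷-injectiveˡ eq
  tabulate-injective f g eq (Fin.suc i) = tabulate-injective (f ∘ Fin.suc) (g ∘ Fin.suc) (∷-injectiveʳ eq) i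

  positions-injective : ∀ {n} (σ τ : Permutation′ n) → positions σ ≡ positions τ → ∀ i → σ ⟨$⟩ˡ i ≡ τ ⟨$⟩ˡ i
  positions-injective σ τ = tabulate-injective (σ ⟨$⟩ˡ_) (τ ⟨$⟩ˡ_)

  tabulate-punchIn : ∀ {a} {A : Set a} {n} (f : Fin (suc n) → A) i →
    let gs = tabulate (f ∘ Fin.punchIn i) in tabulate f ≡ take (toℕ i) gs ++ f i ∷ drop (toℕ i) gs
  tabulate-punchIn               f Fin.zero    = refl
  tabulate-punchIn {n = suc n} f (Fin.suc i) = cong (f Fin.zero ∷_) (tabulate-punchIn (f ∘ Fin.suc) i)

  module _ {n} (i : Fin (suc n)) (π : Permutation′ n) where

    insert-ˡ : insert Fin.zero i π ⟨$⟩ˡ i ≡ Fin.zero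
    insert-ˡ = inverseˡ (insert Fin.zero i π) {Fin.zero}

    insert-ˡ-punchIn : ∀ k → insert Fin.zero i π ⟨$⟩ˡ Fin.punchIn i k ≡ Fin.suc (π ⟨$⟩ˡ k)
    insert-ˡ-punchIn k = trans
      (cong (insert Fin.zero i π ⟨$⟩ˡ_) (sym (trans (insert-punchIn Fin.zero i π (π ⟨$⟩ˡ k))
        (cong (Fin.punchIn i) (inverseʳ π)))))
      (inverseˡ (insert Fin.zero i π))

    -- Prefixing the value `i` to a permutation places a new least letter at index `i` in the word
    -- of the inverse; so `permutations` builds the inverse words by placing their least letters.
    positions-insert : let ps = map Fin.suc (positions π) in
      positions (insert Fin.zero i π) ≡ take (toℕ i) ps ++ Fin.zero ∷ drop (toℕ i) ps
    positions-insert rewrite map-tabulate (π ⟨$⟩ˡ_) Fin.suc = trans (tabulate-punchIn (insert Fin.zero i π ⟨$⟩ˡ_) i)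
      (cong₂ (λ qs x → take (toℕ i) qs ++ x ∷ drop (toℕ i) qs) (tabulate-cong insert-ˡ-punchIn) insert-ˡ)

  take-length-++ : ∀ {a} {A : Set a} (xs ys : List A) → take (length xs) (xs ++ ys) ≡ xs
  take-length-++ []       ys = refl
  take-length-++ (x ∷ xs) ys = cong (x ∷_) (take-length-++ xs ys)

  drop-length-++ : ∀ {a} {A : Set a} (xs ys : List A) → drop (length xs) (xs ++ ys) ≡ ys
  drop-length-++ []       ys = refl
  drop-length-++ (x ∷ xs) ys = drop-length-++ xs ys

  -- The place of the letter 0 determines the inserted value `i`; deleting it and lowering the other
  -- letters leaves a rearrangement of `allFin n`.
  ↭⇒positions : ∀ n {ps} → ps ↭ allFin n → ∃ λ σ → σ ∈ permutations n × positions σ ≡ ps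
  ↭⇒positions zero    p = idₚ , here refl , sym (↭.↭-empty-inv p)
  ↭⇒positions (suc n) p
    with us , vs , refl ← ∈-∃++ (↭.∈-resp-↭ (↭-sym p) (∈-allFin Fin.zero))
    with qs , us++vs≡ , q ← ↭.↭-map-inv Fin.suc (↭-sym (↭-trans (↭.drop-mid us [] p)
           (↭-reflexive (sym (map-tabulate id Fin.suc)))))
    with π , π∈ , refl ← ↭⇒positions n (↭-sym q) =
    insert Fin.zero i π ,
    ∈-concat⁺′ (∈-map⁺ (insert Fin.zero i) π∈)
               (∈-map⁺ (λ i → map (insert Fin.zero i) (permutations n)) (∈-allFin i)) ,
    trans (positions-insert i π)
      (cong₂ (λ as bs → as ++ Fin.zero ∷ bs)
        (trans (cong₂ take i≡ (sym us++vs≡)) (take-length-++ us vs))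
        (trans (cong₂ drop i≡ (sym us++vs≡)) (drop-length-++ us vs)))
    where
    len : length us < suc n
    len = s≤s (subst (length us ≤_)
      (trans (sym (length-++ us)) (trans (cong length us++vs≡) (trans (length-map Fin.suc (positions π)) (length-tabulate (π ⟨$⟩ˡ_)))))
      (m≤m+n (length us) (length vs)))
    i = Fin.fromℕ< len
    i≡ : toℕ i ≡ length us
    i≡ = Fin.toℕ-fromℕ< len

  -- Permutations consist of functions and proofs, so their distinctness is stated for the inverse
  -- words, which are lists. Insertions with different `i` differ in the place of 0.
  positions-permutations-unique : ∀ n → Unique (map positions (permutations n))
  positions-permutations-unique n = AllPairs.map⁺ (distinct n)
    where
    Differ : ∀ {n} → Permutation′ n → Permutation′ n → Set
    Differ σ τ = positions σ ≢ positions τ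

    sameStart : ∀ {n} i {π ρ : Permutation′ n} → Differ π ρ → Differ (insert Fin.zero i π) (insert Fin.zero i ρ)
    sameStart i {π} {ρ} π≢ρ eq = π≢ρ (tabulate-cong λ k → Fin.suc-injective
      (trans (sym (insert-ˡ-punchIn i π k)) (trans (positions-injective (insert Fin.zero i π) (insert Fin.zero i ρ) eq (Fin.punchIn i k)) (insert-ˡ-punchIn i ρ k))))

    otherStart : ∀ {n} {i j} → i ≢ j → (π ρ : Permutation′ n) → Differ (insert Fin.zero i π) (insert Fin.zero j ρ)
    otherStart {i = i} {j} i≢j π ρ eq = i≢j (ˡ-injective (insert Fin.zero i π)
      (trans (insert-ˡ i π) (trans (sym (insert-ˡ j ρ)) (sym (positions-injective (insert Fin.zero i π) (insert Fin.zero j ρ) eq j)))))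

    distinct : ∀ n → AllPairs Differ (permutations n)
    distinct zero    = [] ∷ []
    distinct (suc n) = AllPairs.concat⁺
      (All.map⁺ (All.universal (λ i → AllPairs.map⁺ (AllPairs.map (sameStart i) (distinct n))) (allFin (suc n))))
      (AllPairs.map⁺ (AllPairs.map
        (λ i≢j → All.map⁺ (All.universal (λ π → All.map⁺ (All.universal (otherStart i≢j π) (permutations n))) (permutations n)))
        (Unique.allFin⁺ (suc n))))

  -- Both lists are free of repetitions and have the same members, hence agree up to order, which is
  -- all that a sum needs.
  positions-filter : ∀ {n p} {P : Permutation′ n → Set p} (P? : ∀ σ → Dec (P σ)) {pss : List (List (Fin n))} →
                     Unique pss → (∀ {ps} → ps ∈ pss → ps ↭ allFin n) →
                     (∀ σ → P σ → positions σ ∈ pss) → (∀ σ → positions σ ∈ pss → P σ) →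
                     map positions (filter P? (permutations n)) ↭ pss
  positions-filter {n} P? {pss} pss! full to from = unique∧set⇒↭
    (AllPairs.map⁺ (AllPairs.filter⁺ P? (AllPairs.map⁻ (positions-permutations-unique n)))) pss! to′ from′
    where
    to′ : ∀ {ps} → ps ∈ map positions (filter P? (permutations n)) → ps ∈ pss
    to′ ps∈ with σ , σ∈ , refl ← ∈-map⁻ positions ps∈ = to σ (proj₂ (∈-filter⁻ P? {xs = permutations n} σ∈))
    from′ : ∀ {ps} → ps ∈ pss → ps ∈ map positions (filter P? (permutations n))
    from′ ps∈ with σ , σ∈ , refl ← ↭⇒positions n (full ps∈) = ∈-map⁺ positions (∈-filter⁺ P? σ∈ (from σ ps∈))

  -- Half-products as shuffles

  AllPairs-tabulate⁻ : ∀ {a r} {A : Set a} {_∼_ : A → A → Set r} {n} {f : Fin n → A} →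
                       AllPairs _∼_ (tabulate f) → ∀ {i j} → i Fin.< j → f i ∼ f j
  AllPairs-tabulate⁻ (p ∷ _)  {Fin.zero}  {Fin.suc j} _         = All.tabulate⁻ p j
  AllPairs-tabulate⁻ (_ ∷ ps) {Fin.suc i} {Fin.suc j} (s≤s i<j) = AllPairs-tabulate⁻ ps i<j

  module _ {n} (w : Word n) (w-injective : ∀ {i j} → w i ≡ w j → i ≡ j) (α : Permutation′ n) where

    -- For a word without repeated letters, having the inversions of `α` amounts to being increasing
    -- when read at the places listed by the inverse of `α`.
    Std⇒sorted : Std w ≐ α → AllPairs (λ x y → w x < w y) (positions α)
    Std⇒sorted std = AllPairs.tabulate⁺-< sorted
      where
      sorted : ∀ {a b} → a Fin.< b → w (α ⟨$⟩ˡ a) < w (α ⟨$⟩ˡ b)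
      sorted {a} {b} a<b with Fin.<-cmp (α ⟨$⟩ˡ a) (α ⟨$⟩ˡ b)
      ... | tri> _ _ j<i = Equivalence.from (std _ _ j<i)
        (subst₂ Fin._<_ (sym (inverseʳ α)) (sym (inverseʳ α)) a<b)
      ... | tri≈ _ i≡j _ = contradiction a<b (Fin.<-irrefl (ˡ-injective α i≡j))
      ... | tri< i<j i≢j _ with <-cmp (w (α ⟨$⟩ˡ a)) (w (α ⟨$⟩ˡ b))
      ...   | tri< lt _ _ = lt
      ...   | tri≈ _ eq _ = contradiction (w-injective eq) i≢j
      ...   | tri> _ _ gt = contradiction a<b (<-asym
        (subst₂ Fin._<_ (inverseʳ α) (inverseʳ α) (Equivalence.to (std _ _ i<j) gt)))

    sorted⇒Std : AllPairs (λ x y → w x < w y) (positions α) → Std w ≐ α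
    sorted⇒Std sorted i j i<j = mk⇔ to mono
      where
      mono : ∀ {x y} → word α x < word α y → w x < w y
      mono lt = subst₂ (λ x y → w x < w y) (inverseˡ α) (inverseˡ α) (AllPairs-tabulate⁻ sorted lt)
      to : w j < w i → word α j < word α i
      to lt with <-cmp (word α j) (word α i)
      ... | tri< lt′ _ _ = lt′
      ... | tri≈ _ eq _  = contradiction (sym (ʳ-injective α (Fin.toℕ-injective eq))) (Fin.<⇒≢ i<j)
      ... | tri> _ _ gt  = contradiction lt (<-asym (mono gt))

  -- `maxLetter` is 0 or a letter. The strict inequality excludes the value 0 for `u`, so the
  -- maximum of `u` is attained at some place.
  max<max⇒ : ∀ {k l} (u : Word k) (v : Word l) → maxLetter v < maxLetter u → ∀ y → ∃ λ x → v y < u x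
  max<max⇒ u v lt y with argmax-sel id 0 (tabulate u)
  ... | inj₁ max≡0 = contradiction (subst (maxLetter v <_) max≡0 lt) (λ ())
  ... | inj₂ max∈ with x , max≡ ← ∈-tabulate⁻ max∈ =
    x , ≤-<-trans (All.lookup (xs≤max 0 (tabulate v)) (∈-tabulate⁺ y)) (subst (maxLetter v <_) max≡ lt)

  -- Since `v` is nonempty, some letter of `u` exceeds a letter of `v` and is positive; for empty
  -- `v` both maxima could be the default 0.
  ⇒max<max : ∀ {k l} (u : Word k) (v : Word (suc l)) → (∀ y → ∃ λ x → v y < u x) → maxLetter v < maxLetter u
  ⇒max<max u v below = max[xs]<max[ys]⁺ 0 (tabulate u)
    (inj₂ (Any.map (λ lt → ≤-<-trans z≤n lt) (some Fin.zero)))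
    (All.tabulate⁺ (λ y → inj₂ (some y)))
    where
    some : ∀ y → Any (v y <_) (tabulate u)
    some y with x , lt ← below y = lose (∈-tabulate⁺ x) lt

  module _ {k l} (α : Permutation′ k) (β : Permutation′ (suc l)) where

    -- The places of `u` and of `v` in `γ = uv`, each listed by increasing letter, as prescribed by
    -- `α` and `β`.
    lefts rights : List (Fin (k + suc l))
    lefts  = map (_↑ˡ suc l) (positions α)
    rights = map (k ↑ʳ_) (positions β)

    ↑ˡ≢↑ʳ : ∀ (i : Fin k) (j : Fin (suc l)) → i ↑ˡ suc l ≢ k ↑ʳ j
    ↑ˡ≢↑ʳ i j eq with () ← trans (sym (Fin.splitAt-↑ˡ k i (suc l)))
      (trans (cong (Fin.splitAt k) eq) (Fin.splitAt-↑ʳ k (suc l) j))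

    lefts≢rights : All (λ x → All (x ≢_) rights) lefts
    lefts≢rights = All.map⁺ (All.universal (λ i → All.map⁺ (All.universal (↑ˡ≢↑ʳ i) (positions β))) (positions α))

    lefts++rights-unique : Unique (lefts ++ rights)
    lefts++rights-unique = AllPairs.++⁺
      (Unique.map⁺ (Fin.↑ˡ-injective (suc l) _ _) (positions-unique α))
      (Unique.map⁺ (Fin.↑ʳ-injective k _ _) (positions-unique β))
      lefts≢rights

    ∈-lefts++rights : ∀ i → i ∈ lefts ++ rights
    ∈-lefts++rights i with Fin.splitAt k i in eq
    ... | inj₁ j = subst (_∈ lefts ++ rights) (Fin.splitAt⁻¹-↑ˡ eq)
      (∈-++⁺ˡ (∈-map⁺ (_↑ˡ suc l) (∈-positions α j)))
    ... | inj₂ j = subst (_∈ lefts ++ rights) (Fin.splitAt⁻¹-↑ʳ {k} eq)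
      (∈-++⁺ʳ lefts (∈-map⁺ (k ↑ʳ_) (∈-positions β j)))

    module _ (γ : Permutation′ (k + suc l)) where

      _⊏_ : Fin (k + suc l) → Fin (k + suc l) → Set
      x ⊏ y = word γ x < word γ y

      word-injective : ∀ {x y} → word γ x ≡ word γ y → x ≡ y
      word-injective = ʳ-injective γ ∘ Fin.toℕ-injective

      positions-sorted : AllPairs _⊏_ (positions γ)
      positions-sorted = AllPairs.tabulate⁺-< (subst₂ Fin._<_ (sym (inverseʳ γ)) (sym (inverseʳ γ)))

      halfProduct⇒shuffle : HalfProduct α β γ → positions γ ∈ shuffles lefts rights
      halfProduct⇒shuffle (stdᵘ , stdᵛ , max<) = sorted⇒shuffle <-asym (positions γ) lefts rights
        (unique∧set⇒↭ (positions-unique γ) lefts++rights-unique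
          (λ _ → ∈-lefts++rights _) (λ _ → ∈-positions γ _))
        positions-sorted
        (AllPairs.map⁺ (Std⇒sorted _ (Fin.↑ˡ-injective (suc l) _ _ ∘ word-injective) α stdᵘ))
        (AllPairs.map⁺ (Std⇒sorted _ (Fin.↑ʳ-injective k _ _ ∘ word-injective) β stdᵛ))
        (All.map⁺ (All.universal dominated (positions β)))
        where
        dominated : ∀ y → Any ((k ↑ʳ y) ⊏_) lefts
        dominated y with x , lt ← max<max⇒ (λ i → word γ (i ↑ˡ suc l)) (λ i → word γ (k ↑ʳ i)) max< y =
          lose (∈-map⁺ (_↑ˡ suc l) (∈-positions α x)) lt

      shuffle⇒halfProduct : positions γ ∈ shuffles lefts rights → HalfProduct α β γ
      shuffle⇒halfProduct γ∈ with lefts↗ , rights↗ , dom ← shuffle⇒sorted lefts rights γ∈ positions-sorted =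
        sorted⇒Std _ (Fin.↑ˡ-injective (suc l) _ _ ∘ word-injective) α (AllPairs.map⁻ lefts↗) ,
        sorted⇒Std _ (Fin.↑ʳ-injective k _ _ ∘ word-injective) β (AllPairs.map⁻ rights↗) ,
        ⇒max<max _ _ below
        where
        below : ∀ y → ∃ λ x → word γ (k ↑ʳ y) < word γ (x ↑ˡ suc l)
        below y with _ , x∈ , lt ← find (All.lookup dom (∈-map⁺ (k ↑ʳ_) (∈-positions β y)))
                with x , _ , refl ← ∈-map⁻ (_↑ˡ suc l) x∈ = x , lt

    -- Listing the places of `γ` by increasing letter interleaves the places of `u` with those of
    -- `v`, and `max v < max u` says that the list ends in `u`.
    positions-halfProduct : map positions (filter (halfProduct? α β) (permutations (k + suc l))) ↭ shuffles lefts rights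
    positions-halfProduct = positions-filter (halfProduct? α β) (shuffles-unique lefts rights lefts≢rights)
      (λ ps∈ → ↭-trans (shuffles-↭ lefts rights ps∈)
        (unique∧set⇒↭ lefts++rights-unique (Unique.allFin⁺ _) (λ _ → ∈-allFin _) (λ _ → ∈-lefts++rights _)))
      halfProduct⇒shuffle shuffle⇒halfProduct

  -- Descents and ascending factors

  runsFrom-head : ∀ k x p → ∃₂ λ h T → runsFrom k x p ≡ h ∷ T × suc k ≤ value h
  runsFrom-head k x [] = 1+ k , [] , refl , ≤-refl
  runsFrom-head k x (y ∷ p) with y <? x
  ... | yes _ = 1+ k , runsFrom 0 y p , refl , ≤-refl
  ... | no  _ with h , T , eq , le ← runsFrom-head (suc k) y p = h , T , eq , <⇒≤ le

  -- ascending I p holds if p splits into ascending factors whose lengths are the parts of I;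
  -- in ascendingFrom c x, the factor being read has last letter x and lacks c letters.
  ascending     : Composition → List ℕ → Bool
  ascendingFrom : ℕ → ℕ → Composition → List ℕ → Bool
  ascending []            []      = true
  ascending []            (_ ∷ _) = false
  ascending (_ ∷ _)       []      = false
  ascending ((1+ c) ∷ I)  (x ∷ p) = ascendingFrom c x I p
  ascendingFrom zero    x I p       = ascending I p
  ascendingFrom (suc c) x I []      = false
  ascendingFrom (suc c) x I (y ∷ p) with y <? x
  ... | yes _ = false
  ... | no  _ = ascendingFrom c y I p

  -- Since the last descent `k + 1` letters have been read, and the part being filled, merged with
  -- the earlier ones that it extends, has `k + c + 1`; hence `n ≡ k + c`. A descent while `c` is
  -- positive would give a run shorter than the first part of any coarsening. At `c = 0` a descent
  -- keeps the next part separate and an ascent merges it.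
  runsFrom⇒ascending : ∀ k c {n} x I p → n ≡ k + c →
                       runsFrom k x p ∈ coarsenings⁺ (1+ n) I → T (ascendingFrom c x I p)
  runsFrom⇒ascending k (suc c) x I [] refl J∈
    with _ , _ , refl , s≤s le ← coarsenings-head _ I J∈ =
    contradiction (≤-trans (≤-reflexive (sym (+-suc k c))) le) (m+n≮m k c)
  runsFrom⇒ascending k zero x []      [] n≡ J∈ = tt
  runsFrom⇒ascending k zero x (j ∷ I) [] n≡ J∈ with ∈-++⁻ (map _ (coarsenings⁺ j I)) J∈
  ... | inj₁ J∈ˡ with T , T∈ , eq ← ∈-map⁻ _ J∈ˡ with refl ← ∷-injectiveʳ eq
               with _ , _ , () , _ ← coarsenings-head j I T∈
  runsFrom⇒ascending k zero x (j ∷ I) [] refl J∈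
      | inj₂ J∈ʳ with _ , _ , refl , s≤s le ← coarsenings-head _ I J∈ʳ =
    contradiction (≤-trans (s≤s (≤-trans (≤-reflexive (sym (+-identityʳ k))) (m≤m+n _ _))) le) (<-irrefl refl)
  runsFrom⇒ascending k (suc c) x I (y ∷ p) refl J∈ with y <? x
  ... | yes _ with _ , _ , refl , s≤s le ← coarsenings-head _ I J∈ =
    contradiction (≤-trans (≤-reflexive (sym (+-suc k c))) le) (m+n≮m k c)
  ... | no  _ = runsFrom⇒ascending (suc k) c y I p (+-suc k c) J∈
  runsFrom⇒ascending k zero x [] (y ∷ p) refl J∈ with y <? x
  runsFrom⇒ascending k zero x [] (y ∷ p) refl (here eq) | yes _
    with _ , _ , eq′ , _ ← runsFrom-head 0 y p with () ← trans (sym eq′) (∷-injectiveʳ eq)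
  runsFrom⇒ascending k zero x [] (y ∷ p) refl (here eq) | no _
    with h , _ , eq′ , le ← runsFrom-head (suc k) y p with refl ← trans (sym eq′) eq =
    contradiction (≤-trans le (≤-reflexive (cong suc (+-identityʳ k)))) (<-irrefl refl)
  runsFrom⇒ascending k zero x ((1+ d) ∷ I) (y ∷ p) refl J∈
    with y <? x | ∈-++⁻ (map _ (coarsenings⁺ (1+ d) I)) J∈
  ... | yes _ | inj₁ J∈ˡ with T , T∈ , eq ← ∈-map⁻ _ J∈ˡ =
    runsFrom⇒ascending 0 d y I p refl (subst (_∈ coarsenings⁺ (1+ d) I) (sym (∷-injectiveʳ eq)) T∈)
  ... | yes _ | inj₂ J∈ʳ with _ , _ , refl , s≤s le ← coarsenings-head _ I J∈ʳ =
    contradiction (≤-trans (s≤s (≤-trans (≤-reflexive (sym (+-identityʳ k))) (m≤m+n _ _))) le) (<-irrefl refl)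
  ... | no  _ | inj₁ J∈ˡ with h , _ , eq′ , le ← runsFrom-head (suc k) y p
                        with T , T∈ , eq ← ∈-map⁻ _ J∈ˡ with refl ← trans (sym eq′) eq =
    contradiction (≤-trans le (≤-reflexive (cong suc (+-identityʳ k)))) (<-irrefl refl)
  ... | no  _ | inj₂ J∈ʳ =
    runsFrom⇒ascending (suc k) d y I p (cong (λ n → suc (n + d)) (+-identityʳ k)) J∈ʳ

  ascending⇒runsFrom : ∀ k c {n} x I p → n ≡ k + c →
                       T (ascendingFrom c x I p) → runsFrom k x p ∈ coarsenings⁺ (1+ n) I
  ascending⇒runsFrom k zero    x []      []      refl _ = here (cong (λ n → (1+ n) ∷ []) (sym (+-identityʳ k)))
  ascending⇒runsFrom k (suc c) x I       (y ∷ p) refl asc with y <? x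
  ... | no _ = ascending⇒runsFrom (suc k) c y I p (+-suc k c) asc
  ascending⇒runsFrom k zero x ((1+ d) ∷ I) (y ∷ p) refl asc with y <? x
  ... | yes _ = ∈-++⁺ˡ (subst (λ n → (1+ k) ∷ runsFrom 0 y p ∈ map ((1+ n) ∷_) (coarsenings⁺ (1+ d) I))
    (sym (+-identityʳ k)) (∈-map⁺ ((1+ k) ∷_) (ascending⇒runsFrom 0 d y I p refl asc)))
  ... | no  _ = ∈-++⁺ʳ _ (ascending⇒runsFrom (suc k) d y I p (cong (λ n → suc (n + d)) (+-identityʳ k)) asc)

  runs⇒ascending : ∀ I p → runs p ∈ coarsenings I → T (ascending I p)
  runs⇒ascending []           []      _         = tt
  runs⇒ascending []           (x ∷ p) (here eq) with _ , _ , eq′ , _ ← runsFrom-head 0 x p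
                                                with () ← trans (sym eq′) eq
  runs⇒ascending (i ∷ I)      []      J∈        with _ , _ , () , _ ← coarsenings-head i I J∈
  runs⇒ascending ((1+ c) ∷ I) (x ∷ p) J∈        = runsFrom⇒ascending 0 c x I p refl J∈

  ascending⇒runs : ∀ I p → T (ascending I p) → runs p ∈ coarsenings I
  ascending⇒runs []           []      _   = here refl
  ascending⇒runs ((1+ c) ∷ I) (x ∷ p) asc = ascending⇒runsFrom 0 c x I p refl asc

open Combinatorics

-- Identities over the ring of scalars

module _ {c ℓ} (R : CommutativeRing c ℓ) where

  open DecMembership _≟ᶜ_ using (_∈?_)
  open CommutativeRing R hiding (refl; sym; trans; zero)
  open Over R
  open import Algebra.Definitions.RawSemiring (Semiring.rawSemiring semiring) using (_^_)
  open import Algebra.Properties.Ring ring using (-0#≈0#; -‿distribˡ-*; -‿distribʳ-*; -‿+-comm; x∙y⁻¹≈ε⇒x≈y)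
  import Algebra.Properties.CommutativeSemigroup as CommutativeSemigroup
  open CommutativeSemigroup +-commutativeSemigroup using () renaming (interchange to +-interchange)
  open CommutativeSemigroup *-commutativeSemigroup using () renaming (x∙yz≈y∙xz to *-exchange)
  open import Relation.Binary.Reasoning.Setoid setoid

  -- Finite sums

  𝟙-yes : ∀ {p} {P : Set p} (P? : Dec P) → P → 𝟙[ P? ] ≈ 1#
  𝟙-yes (yes _) _ = ≈.refl
  𝟙-yes (no ¬p) p = contradiction p ¬p

  𝟙-cong : ∀ {p q} {P : Set p} {Q : Set q} (P? : Dec P) (Q? : Dec Q) →
           (P → Q) → (Q → P) → 𝟙[ P? ] ≈ 𝟙[ Q? ]
  𝟙-cong (yes p) Q? to from = ≈.sym (𝟙-yes Q? (to p))
  𝟙-cong (no ¬p) Q? to from = ≈.sym (𝟙-no Q? (¬p ∘ from))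

  𝟙-* : ∀ {p q r} {P : Set p} {Q : Set q} {R : Set r} (P? : Dec P) (Q? : Dec Q) (R? : Dec R) →
        (P → Q → R) → (R → P × Q) → 𝟙[ P? ] * 𝟙[ Q? ] ≈ 𝟙[ R? ]
  𝟙-* (yes p) Q? R? to from = ≈.trans (*-identityˡ _) (𝟙-cong Q? R? (to p) (proj₂ ∘ from))
  𝟙-* (no ¬p) Q? R? to from = ≈.trans (zeroˡ _) (≈.sym (𝟙-no R? (¬p ∘ proj₁ ∘ from)))

  module _ {a} {A : Set a} where

    ∑-cong-∈ : ∀ (xs : List A) {f g : A → Carrier} →
               (∀ {x} → x ∈ xs → f x ≈ g x) → ∑ xs f ≈ ∑ xs g
    ∑-cong-∈ []       f≈g = ≈.refl
    ∑-cong-∈ (x ∷ xs) f≈g = +-cong (f≈g (here ≡.refl)) (∑-cong-∈ xs (f≈g ∘ there))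

    ∑-zero-∈ : ∀ (xs : List A) {f : A → Carrier} → (∀ {x} → x ∈ xs → f x ≈ 0#) → ∑ xs f ≈ 0#
    ∑-zero-∈ xs f≈0 = ∑-zero (All.tabulate f≈0)

    ∑-+ : ∀ (xs : List A) {f g : A → Carrier} → ∑ xs (λ x → f x + g x) ≈ ∑ xs f + ∑ xs g
    ∑-+ []       = ≈.sym (+-identityˡ 0#)
    ∑-+ (x ∷ xs) = ≈.trans (+-congˡ (∑-+ xs)) (+-interchange _ _ _ _)

    ∑-neg : ∀ (xs : List A) {f : A → Carrier} → ∑ xs (λ x → - f x) ≈ - ∑ xs f
    ∑-neg []       = ≈.sym -0#≈0#
    ∑-neg (x ∷ xs) = ≈.trans (+-congˡ (∑-neg xs)) (-‿+-comm _ _)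

    ∑-*ˡ : ∀ k (xs : List A) {f : A → Carrier} → k * ∑ xs f ≈ ∑ xs (λ x → k * f x)
    ∑-*ˡ k []       = zeroʳ k
    ∑-*ˡ k (x ∷ xs) = ≈.trans (distribˡ k _ _) (+-congˡ (∑-*ˡ k xs))

    ∑-*ʳ : ∀ k (xs : List A) {f : A → Carrier} → ∑ xs f * k ≈ ∑ xs (λ x → f x * k)
    ∑-*ʳ k []       = zeroˡ k
    ∑-*ʳ k (x ∷ xs) = ≈.trans (distribʳ k _ _) (+-congˡ (∑-*ʳ k xs))

    ∑-pick : ∀ {xs : List A} {y} {f : A → Carrier} → Unique xs → y ∈ xs →
             (∀ {x} → x ≢ y → f x ≈ 0#) → ∑ xs f ≈ f y
    ∑-pick {x ∷ xs} (x∉ ∷ _) (here ≡.refl) f≈0 = ≈.trans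
      (+-congˡ (∑-zero (All.map (λ x≢ → f≈0 (x≢ ∘ ≡.sym)) x∉))) (+-identityʳ _)
    ∑-pick {x ∷ xs} (x∉ ∷ xs!) (there y∈) f≈0 = ≈.trans
      (+-cong (f≈0 (All.lookup x∉ y∈)) (∑-pick xs! y∈ f≈0)) (+-identityˡ _)

    ∑-↭ : ∀ {xs ys : List A} {f : A → Carrier} → xs ↭ ys → ∑ xs f ≈ ∑ ys f
    ∑-↭ Perm.refl         = ≈.refl
    ∑-↭ (Perm.prep x p)   = +-congˡ (∑-↭ p)
    ∑-↭ (Perm.swap x y p) = ≈.trans (+-congˡ (+-congˡ (∑-↭ p)))
      (≈.trans (≈.sym (+-assoc _ _ _)) (≈.trans (+-congʳ (+-comm _ _)) (+-assoc _ _ _)))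
    ∑-↭ (Perm.trans p q)  = ≈.trans (∑-↭ p) (∑-↭ q)

    ∑-filter : ∀ {p} {P : A → Set p} (P? : ∀ x → Dec (P x)) (xs : List A) {f : A → Carrier} →
               ∑ (filter P? xs) f ≈ ∑ xs (λ x → 𝟙[ P? x ] * f x)
    ∑-filter P? []       = ≈.refl
    ∑-filter P? (x ∷ xs) with P? x
    ... | yes _ = +-cong (≈.sym (*-identityˡ _)) (∑-filter P? xs)
    ... | no  _ = ≈.trans (∑-filter P? xs) (≈.sym (≈.trans (+-congʳ (zeroˡ _)) (+-identityˡ _)))

  ∑-comm : ∀ {a b} {A : Set a} {B : Set b} (xs : List A) (ys : List B) {f : A → B → Carrier} →
           ∑ xs (λ x → ∑ ys (f x)) ≈ ∑ ys (λ y → ∑ xs (λ x → f x y))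
  ∑-comm []       ys = ≈.sym (∑-zero-∈ ys (λ _ → ≈.refl))
  ∑-comm (x ∷ xs) ys = ≈.trans (+-congˡ (∑-comm xs ys)) (≈.sym (∑-+ ys))

  ∑-restrict : ∀ {xs ys : List Composition} {f : Composition → Carrier} →
               Unique xs → Unique ys → (∀ {y} → y ∈ ys → y ∈ xs) →
               ∑ xs (λ x → f x * 𝟙[ x ∈? ys ]) ≈ ∑ ys f
  ∑-restrict {xs} {ys} {f} xs! ys! ys⊆xs = begin
    ∑ xs (λ x → f x * 𝟙[ x ∈? ys ])            ≈⟨ ∑-cong xs (λ x → *-congˡ (count x)) ⟨
    ∑ xs (λ x → f x * ∑ ys (λ y → δ x y))      ≈⟨ ∑-cong xs (λ x → ∑-*ˡ (f x) ys) ⟩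
    ∑ xs (λ x → ∑ ys (λ y → f x * δ x y))      ≈⟨ ∑-comm xs ys ⟩
    ∑ ys (λ y → ∑ xs (λ x → f x * δ x y))      ≈⟨ ∑-cong-∈ ys pick ⟩
    ∑ ys f                                     ∎
    where
    δ : Composition → Composition → Carrier
    δ x y = 𝟙[ x ≟ᶜ y ]
    count : ∀ x → ∑ ys (δ x) ≈ 𝟙[ x ∈? ys ]
    count x with x ∈? ys
    ... | yes x∈ = ≈.trans (∑-pick ys! x∈ (λ {y} y≢x → 𝟙-no (x ≟ᶜ y) (y≢x ∘ ≡.sym))) (𝟙-yes (x ≟ᶜ x) ≡.refl)
    ... | no  x∉ = ∑-zero-∈ ys (λ {y} y∈ → 𝟙-no (x ≟ᶜ y) (λ { ≡.refl → x∉ y∈ }))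
    pick : ∀ {y} → y ∈ ys → ∑ xs (λ x → f x * δ x y) ≈ f y
    pick {y} y∈ = ≈.trans
      (∑-pick xs! (ys⊆xs y∈) (λ {x} x≢y → ≈.trans (*-congˡ (𝟙-no (x ≟ᶜ y) x≢y)) (zeroʳ _)))
      (≈.trans (*-congˡ (𝟙-yes (y ≟ᶜ y) ≡.refl)) (*-identityʳ _))

  ∑-upTo : ∀ n {f : ℕ → Carrier} → ∑ (upTo (suc n)) f ≈ f 0 + ∑ (upTo n) (f ∘ suc)
  ∑-upTo n {f} = +-congˡ (≈.trans (reflexive (cong (λ xs → ∑ xs f) (≡.sym (map-upTo suc n)))) (∑-map suc (upTo n)))

  -- Products of quasi-symmetric functions

  ∑-splittings-∷ : ∀ n e {f : List ℕ × List ℕ → Carrier} → ∑ (splittings (n ∷ e)) f ≈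
                   ∑ (upTo (suc n)) (λ k → ∑ (splittings e) (λ (a , b) → f (k ∷ a , (n ∸ k) ∷ b)))
  ∑-splittings-∷ n e {f} = ≈.trans
    (∑-concatMap (λ k → map (prepend k) (splittings e)) (upTo (suc n)))
    (∑-cong (upTo (suc n)) (λ k → ∑-map (prepend k) (splittings e) {f}))
    where
    prepend : ℕ → List ℕ × List ℕ → List ℕ × List ℕ
    prepend k (a , b) = k ∷ a , (n ∸ k) ∷ b

  conv-cong : ∀ {f f′ g g′ : List ℕ → Carrier} e → (∀ a → f a ≈ f′ a) → (∀ b → g b ≈ g′ b) →
              conv f g e ≈ conv f′ g′ e
  conv-cong e f≈f′ g≈g′ = ∑-cong (splittings e) (λ (a , b) → *-cong (f≈f′ a) (g≈g′ b))

  -- `splittings` recurses on the first variable; peeling off the last one as well is what lets the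
  -- reversal of variables pass through products.
  conv-∷ʳ : ∀ f g n e → conv f g (e ∷ʳ n) ≈
            ∑ (upTo (suc n)) (λ k → conv (f ∘ (_∷ʳ k)) (g ∘ (_∷ʳ (n ∸ k))) e)
  conv-∷ʳ f g n []      = conv-∷ f g n []
  conv-∷ʳ f g n (m ∷ e) = begin
    conv f g (m ∷ (e ∷ʳ n))
      ≈⟨ conv-∷ f g m (e ∷ʳ n) ⟩
    ∑ (upTo (suc m)) (λ i → conv (f ∘ (i ∷_)) (g ∘ ((m ∸ i) ∷_)) (e ∷ʳ n))
      ≈⟨ ∑-cong (upTo (suc m)) (λ i → conv-∷ʳ (f ∘ (i ∷_)) (g ∘ ((m ∸ i) ∷_)) n e) ⟩
    ∑ (upTo (suc m)) (λ i → ∑ (upTo (suc n)) (λ k →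
      conv (λ a → f (i ∷ (a ∷ʳ k))) (λ b → g ((m ∸ i) ∷ (b ∷ʳ (n ∸ k)))) e))
      ≈⟨ ∑-comm (upTo (suc m)) (upTo (suc n)) ⟩
    ∑ (upTo (suc n)) (λ k → ∑ (upTo (suc m)) (λ i →
      conv (λ a → f (i ∷ (a ∷ʳ k))) (λ b → g ((m ∸ i) ∷ (b ∷ʳ (n ∸ k)))) e))
      ≈⟨ ∑-cong (upTo (suc n)) (λ k → conv-∷ (f ∘ (_∷ʳ k)) (g ∘ (_∷ʳ (n ∸ k))) m e) ⟨
    ∑ (upTo (suc n)) (λ k → conv (f ∘ (_∷ʳ k)) (g ∘ (_∷ʳ (n ∸ k))) (m ∷ e)) ∎

  conv-reverse : ∀ f g e → conv f g (reverse e) ≈ conv (f ∘ reverse) (g ∘ reverse) e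
  conv-reverse f g []      = ≈.refl
  conv-reverse f g (n ∷ e) = begin
    conv f g (reverse (n ∷ e))
      ≡⟨ cong (conv f g) (unfold-reverse n e) ⟩
    conv f g (reverse e ∷ʳ n)
      ≈⟨ conv-∷ʳ f g n (reverse e) ⟩
    ∑ (upTo (suc n)) (λ k → conv (f ∘ (_∷ʳ k)) (g ∘ (_∷ʳ (n ∸ k))) (reverse e))
      ≈⟨ ∑-cong (upTo (suc n)) (λ k → ≈.trans
           (conv-reverse (f ∘ (_∷ʳ k)) (g ∘ (_∷ʳ (n ∸ k))) e)
           (conv-cong e (λ a → reflexive (cong f (≡.sym (unfold-reverse k a))))
                        (λ b → reflexive (cong g (≡.sym (unfold-reverse (n ∸ k) b)))))) ⟩
    ∑ (upTo (suc n)) (λ k → conv (f ∘ reverse ∘ (k ∷_)) (g ∘ reverse ∘ ((n ∸ k) ∷_)) e)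
      ≈⟨ conv-∷ (f ∘ reverse) (g ∘ reverse) n e ⟨
    conv (f ∘ reverse) (g ∘ reverse) (n ∷ e) ∎

  -- For h the indicator of n, this is the product of g with the complete function h_n.
  convₛ : (ℕ → Carrier) → (List ℕ → Carrier) → List ℕ → Carrier
  convₛ h g = conv (h ∘ sum) g

  convₛ-[] : ∀ h g → convₛ h g [] ≈ h 0 * g []
  convₛ-[] h g = +-identityʳ _

  convₛ-zero : ∀ h g e → convₛ h g (0 ∷ e) ≈ convₛ h (g ∘ (0 ∷_)) e
  convₛ-zero h g e = ≈.trans (conv-∷ (h ∘ sum) g 0 e) (+-identityʳ _)

  -- A monomial of a complete function either avoids the first variable or contains it; in the
  -- second case one factor is split off and the degree drops by one.
  convₛ-suc : ∀ h g k e → convₛ h g (suc k ∷ e) ≈ convₛ h (g ∘ (suc k ∷_)) e + convₛ (h ∘ suc) g (k ∷ e)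
  convₛ-suc h g k e = ≈.trans (conv-∷ (h ∘ sum) g (suc k) e) (≈.trans (∑-upTo (suc k))
    (+-congˡ (≈.sym (conv-∷ (h ∘ suc ∘ sum) g k e))))

  -- Alternating sums of products with elementary functions

  -- The coefficient of the monomial with exponents `a` in the product of all `1 - x_i`, the
  -- alternating sum of the elementary functions.
  sg : List ℕ → Carrier
  sg []                = 1#
  sg (zero ∷ a)        = sg a
  sg (suc zero ∷ a)    = - sg a
  sg (suc (suc _) ∷ a) = 0#

  -- The sum of (-1)^i F_{1^i} g_i over all i.
  E : (ℕ → List ℕ → Carrier) → List ℕ → Carrier
  E g e = ∑ (splittings e) (λ (a , b) → sg a * g (sum a) b)

  E-cong : ∀ {g g′ : ℕ → List ℕ → Carrier} e → (∀ i b → g i b ≈ g′ i b) → E g e ≈ E g′ e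
  E-cong e g≈g′ = ∑-cong (splittings e) (λ (a , b) → *-congˡ (g≈g′ (sum a) b))

  E-+ : ∀ (g g′ : ℕ → List ℕ → Carrier) e → E (λ i b → g i b + g′ i b) e ≈ E g e + E g′ e
  E-+ g g′ e = ≈.trans (∑-cong (splittings e) (λ _ → distribˡ _ _ _)) (∑-+ (splittings e))

  E-[] : ∀ g → E g [] ≈ g 0 []
  E-[] g = ≈.trans (+-identityʳ _) (*-identityˡ _)

  E-zero : ∀ g e → E g (0 ∷ e) ≈ E (λ i b → g i (0 ∷ b)) e
  E-zero g e = ≈.trans (∑-splittings-∷ 0 e) (+-identityʳ _)

  -- The factor `1 - x₁` contributes the exponents 0 and 1 only.
  E-suc : ∀ g k e → E g (suc k ∷ e) ≈ E (λ i b → g i (suc k ∷ b)) e - E (λ i b → g (suc i) (k ∷ b)) e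
  E-suc g k e = begin
    E g (suc k ∷ e)
      ≈⟨ ∑-splittings-∷ (suc k) e ⟩
    ∑ (upTo (suc (suc k))) row
      ≈⟨ ∑-upTo (suc k) ⟩
    row 0 + ∑ (upTo (suc k)) (row ∘ suc)
      ≈⟨ +-congˡ (∑-upTo k) ⟩
    row 0 + (row 1 + ∑ (upTo k) (λ i → row (suc (suc i))))
      ≈⟨ +-congˡ (+-congˡ (∑-zero-∈ (upTo k) (λ _ → ∑-zero-∈ (splittings e) (λ _ → zeroˡ _)))) ⟩
    row 0 + (row 1 + 0#)
      ≈⟨ +-congˡ (+-identityʳ _) ⟩
    row 0 + row 1
      ≈⟨ +-congˡ (≈.trans (∑-cong (splittings e) (λ _ → ≈.sym (-‿distribˡ-* _ _))) (∑-neg (splittings e))) ⟩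
    E (λ i b → g i (suc k ∷ b)) e - E (λ i b → g (suc i) (k ∷ b)) e ∎
    where
    row : ℕ → Carrier
    row i = ∑ (splittings e) (λ (a , b) → sg (i ∷ a) * g (sum (i ∷ a)) ((suc k ∸ i) ∷ b))

  -- For χ the indicator of n, this is ∑ (-1)^i e_i h_{n-i} = [n = 0], multiplied by f.
  E-convₛ : ∀ (χ : ℕ → Carrier) f e → E (λ i → convₛ (λ s → χ (i ℕ.+ s)) f) e ≈ χ 0 * f e
  E-convₛ χ f []         = ≈.trans (E-[] (λ i → convₛ (λ s → χ (i ℕ.+ s)) f)) (convₛ-[] χ f)
  E-convₛ χ f (zero ∷ e) = ≈.trans (E-zero (λ i → convₛ (λ s → χ (i ℕ.+ s)) f) e) (≈.trans
    (E-cong e (λ i → convₛ-zero (λ s → χ (i ℕ.+ s)) f)) (E-convₛ χ (f ∘ (0 ∷_)) e))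
  E-convₛ χ f (suc k ∷ e) = begin
    E (λ i → convₛ (χ₊ i) f) (suc k ∷ e)
      ≈⟨ E-suc (λ i → convₛ (χ₊ i) f) k e ⟩
    E (λ i b → convₛ (χ₊ i) f (suc k ∷ b)) e - X
      ≈⟨ +-congʳ (E-cong e (λ i b → ≈.trans (convₛ-suc (χ₊ i) f k b)
           (+-congˡ (conv-cong (k ∷ b) (λ a → reflexive (cong χ (ℕ.+-suc i (sum a)))) (λ _ → ≈.refl))))) ⟩
    E (λ i b → convₛ (χ₊ i) (f ∘ (suc k ∷_)) b + convₛ (χ₊ (suc i)) f (k ∷ b)) e - X
      ≈⟨ +-congʳ (E-+ (λ i → convₛ (χ₊ i) (f ∘ (suc k ∷_))) (λ i b → convₛ (χ₊ (suc i)) f (k ∷ b)) e) ⟩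
    -- `X` arises twice with opposite signs: from the elementary functions containing the first
    -- variable and from the complete functions containing it. This is `1 - x₁` cancelling its
    -- inverse.
    (E (λ i → convₛ (χ₊ i) (f ∘ (suc k ∷_))) e + X) - X
      ≈⟨ +-assoc _ _ _ ⟩
    E (λ i → convₛ (χ₊ i) (f ∘ (suc k ∷_))) e + (X - X)
      ≈⟨ +-cong (E-convₛ χ (f ∘ (suc k ∷_)) e) (-‿inverseʳ X) ⟩
    χ 0 * f (suc k ∷ e) + 0#
      ≈⟨ +-identityʳ _ ⟩
    χ 0 * f (suc k ∷ e) ∎
    where
    χ₊ : ℕ → ℕ → Carrier
    χ₊ i s = χ (i ℕ.+ s)
    X : Carrier
    X = E (λ i b → convₛ (χ₊ (suc i)) f (k ∷ b)) e

  -- Linear functionals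

  -- Elements of `Free` are unreduced lists of terms, so identities between them are expressed
  -- through linear functionals, given by their values `φ` on the basis.
  eval : ∀ {b} {B : Set b} → Free B → (B → Carrier) → Carrier
  eval x φ = ∑ x (λ (k , y) → k * φ y)

  module _ {b} {B : Set b} where

    eval-cong : ∀ (x : Free B) {φ ψ : B → Carrier} → (∀ y → φ y ≈ ψ y) → eval x φ ≈ eval x ψ
    eval-cong x φ≈ψ = ∑-cong x (λ (k , y) → *-congˡ (φ≈ψ y))

    eval-zero : ∀ (x : Free B) {φ : B → Carrier} → (∀ y → φ y ≈ 0#) → eval x φ ≈ 0#
    eval-zero x φ≈0 = ∑-zero-∈ x (λ _ → ≈.trans (*-congˡ (φ≈0 _)) (zeroʳ _))

    eval-basis : ∀ (y : B) (φ : B → Carrier) → eval (basis y) φ ≈ φ y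
    eval-basis y φ = ≈.trans (+-identityʳ _) (*-identityˡ _)

    eval-· : ∀ k (x : Free B) (φ : B → Carrier) → eval (k · x) φ ≈ k * eval x φ
    eval-· k x φ = ≈.trans (∑-map (λ (l , y) → (k * l , y)) x)
      (≈.trans (∑-cong x (λ _ → *-assoc _ _ _)) (≈.sym (∑-*ˡ k x)))

    eval-∑ : ∀ {a} {A : Set a} (x : Free B) (ys : List A) {φ : A → B → Carrier} →
             eval x (λ z → ∑ ys (λ y → φ y z)) ≈ ∑ ys (λ y → eval x (φ y))
    eval-∑ x ys = ≈.trans (∑-cong x (λ _ → ∑-*ˡ _ ys)) (∑-comm x ys)

  module _ {b} {B : Set b} where

    eval-linear : ∀ {a} {A : Set a} (f : A → Free B) (x : Free A) (φ : B → Carrier) →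
                  eval (linear f x) φ ≈ eval x (λ y → eval (f y) φ)
    eval-linear f x φ = ≈.trans (∑-concatMap (λ (k , y) → k · f y) x)
      (∑-cong x (λ (k , y) → eval-· k (f y) φ))

    eval-bilinear : ∀ {a₁ a₂} {A₁ : Set a₁} {A₂ : Set a₂} (f : A₁ → A₂ → Free B) x y (φ : B → Carrier) →
                    eval (bilinear f x y) φ ≈ eval x (λ s → eval y (λ t → eval (f s t) φ))
    eval-bilinear f x y φ = ≈.trans (eval-linear (λ s → linear (f s) y) x φ)
      (eval-cong x (λ s → eval-linear (f s) y φ))

    coeff-linearQ : ∀ (f : B → QSym) x e → coeff (linearQ f x) e ≈ eval x (λ y → coeff (f y) e)
    coeff-linearQ f []      e = ≈.refl
    coeff-linearQ f (_ ∷ x) e = +-congˡ (coeff-linearQ f x e)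

  -- The adjoint of the creation operators

  𝟙-ones : ∀ i K → 𝟙[ replicate i (1+ 0) ∈? coarsenings K ] ≈ 𝟙[ K ≟ᶜ replicate i (1+ 0) ]
  𝟙-ones i K = 𝟙-cong (_ ∈? coarsenings K) (K ≟ᶜ _) (replicate-∈-coarsenings i K)
    (λ { ≡.refl → self-∈-coarsenings K })

  sg-ones : ∀ a → (- 1#) ^ sum a * 𝟙[ nonzeros a ≟ᶜ replicate (sum a) (1+ 0) ] ≈ sg a
  sg-ones []             = *-identityˡ _
  sg-ones (zero ∷ a)     = sg-ones a
  sg-ones (suc zero ∷ a) = begin
    (- 1# * (- 1#) ^ sum a) * 𝟙[ ((1+ 0) ∷ nonzeros a) ≟ᶜ ((1+ 0) ∷ replicate (sum a) (1+ 0)) ]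
      ≈⟨ *-assoc _ _ _ ⟩
    - 1# * ((- 1#) ^ sum a * 𝟙[ ((1+ 0) ∷ nonzeros a) ≟ᶜ ((1+ 0) ∷ replicate (sum a) (1+ 0)) ])
      ≈⟨ *-congˡ (*-congˡ (𝟙-cong (((1+ 0) ∷ nonzeros a) ≟ᶜ ((1+ 0) ∷ replicate (sum a) (1+ 0))) (nonzeros a ≟ᶜ _) ∷-injectiveʳ (cong (_ ∷_)))) ⟩
    - 1# * ((- 1#) ^ sum a * 𝟙[ nonzeros a ≟ᶜ replicate (sum a) (1+ 0) ])
      ≈⟨ *-congˡ (sg-ones a) ⟩
    - 1# * sg a
      ≈⟨ -‿distribˡ-* 1# (sg a) ⟨
    - (1# * sg a)
      ≈⟨ -‿cong (*-identityˡ _) ⟩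
    - sg a ∎
  sg-ones (suc (suc k) ∷ a) = ≈.trans
    (*-congˡ (𝟙-no (nonzeros (suc (suc k) ∷ a) ≟ᶜ replicate (sum (suc (suc k) ∷ a)) (1+ 0)) (λ ())))
    (zeroʳ _)

  -- For degree reasons only `i = sum a` contributes, and `sum a < n` ensures that it occurs in the
  -- finite sum.
  ∑-elementary : ∀ a n → sum a < n → (h : ℕ → Carrier) →
                 ∑ (upTo n) (λ i → (- 1#) ^ i * (coeff (F (replicate i (1+ 0))) a * h i)) ≈ sg a * h (sum a)
  ∑-elementary a n s<n h = ≈.trans (∑-pick (Unique.upTo⁺ n) (∈-upTo⁺ s<n) vanish)
    (≈.trans (≈.sym (*-assoc _ _ _)) (*-congʳ (≈.trans (*-congˡ (𝟙-ones (sum a) (nonzeros a))) (sg-ones a))))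
    where
    vanish : ∀ {i} → i ≢ sum a → (- 1#) ^ i * (coeff (F (replicate i (1+ 0))) a * h i) ≈ 0#
    vanish {i} i≢ = ≈.trans (*-congˡ (≈.trans (*-congʳ (𝟙-no (_ ∈? coarsenings (nonzeros a))
      (λ i∈ → i≢ (≡.trans (≡.sym (size-replicate i)) (≡.trans (size-coarsenings (nonzeros a) i∈) (size-nonzeros a))))))
      (zeroˡ _))) (zeroʳ _)

  splittings-sum : ∀ e {a b} → (a , b) ∈ splittings e → sum a ℕ.+ sum b ≡ sum e
  splittings-sum e = All.lookup (sum-splittings e)

  -- Pairing `S^I` with a product sums over the splittings of `I`. For each splitting a single `J`
  -- survives, namely `nonzeros b`, whose size is at most `size I`, so that the truncated list
  -- contains it.
  eval-⊥ : ∀ f I φ → eval ((f ⊥) (basis I)) φ ≈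
           ∑ (splittings (parts I)) (λ (a , b) → coeff f a * φ (nonzeros b))
  eval-⊥ f I φ = begin
    eval ((f ⊥) (basis I)) φ
      ≈⟨ eval-linear (λ I → map (λ J → (⟨ basis I , f *̂ M J ⟩ , J)) (compositionsUpTo (size I))) (basis I) φ ⟩
    eval (basis I) (λ I → eval (map (λ J → (⟨ basis I , f *̂ M J ⟩ , J)) (compositionsUpTo (size I))) φ)
      ≈⟨ eval-basis I (λ I → eval (map (λ J → (⟨ basis I , f *̂ M J ⟩ , J)) (compositionsUpTo (size I))) φ) ⟩
    eval (map (λ J → (⟨ basis I , f *̂ M J ⟩ , J)) Js) φ
      ≈⟨ ∑-map (λ J → (⟨ basis I , f *̂ M J ⟩ , J)) Js ⟩
    ∑ Js (λ J → ⟨ basis I , f *̂ M J ⟩ * φ J)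
      ≈⟨ ∑-cong Js (λ J → ≈.trans (*-congʳ (eval-basis I (coeff (f *̂ M J) ∘ parts))) (∑-*ʳ (φ J) ss)) ⟩
    ∑ Js (λ J → ∑ ss (λ (a , b) → (coeff f a * 𝟙[ nonzeros b ≟ᶜ J ]) * φ J))
      ≈⟨ ∑-comm Js ss ⟩
    ∑ ss (λ (a , b) → ∑ Js (λ J → (coeff f a * 𝟙[ nonzeros b ≟ᶜ J ]) * φ J))
      ≈⟨ ∑-cong-∈ ss (λ {(a , b)} → pick a b) ⟩
    ∑ ss (λ (a , b) → coeff f a * φ (nonzeros b)) ∎
    where
    ss = splittings (parts I)
    Js = compositionsUpTo (size I)
    pick : ∀ a b → (a , b) ∈ ss →
           ∑ Js (λ J → (coeff f a * 𝟙[ nonzeros b ≟ᶜ J ]) * φ J) ≈ coeff f a * φ (nonzeros b)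
    pick a b ab∈ = ≈.trans
      (∑-pick (compositionsUpTo-unique (size I))
        (∈-compositionsUpTo (size I) (≡.subst₂ _≤_ (≡.sym (size-nonzeros b)) (splittings-sum (parts I) ab∈)
          (ℕ.m≤n+m (sum b) (sum a))))
        (λ {J} J≢ → ≈.trans (*-congʳ (≈.trans (*-congˡ (𝟙-no (nonzeros b ≟ᶜ J) (J≢ ∘ ≡.sym))) (zeroʳ _))) (zeroˡ _)))
      (*-congʳ (≈.trans (*-congˡ (𝟙-yes (nonzeros b ≟ᶜ nonzeros b) ≡.refl)) (*-identityʳ _)))

  -- The adjoint of 𝔹 (m + 1).
  𝔹ᵀ : ℕ → (Composition → Carrier) → Composition → Carrier
  𝔹ᵀ m φ I = E (λ i b → φ ((1+ (m ℕ.+ i)) ∷ nonzeros b)) (parts I)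

  eval-𝔹 : ∀ m H φ → eval (𝔹 (ℤ.+ suc m) H) φ ≈ eval H (𝔹ᵀ m φ)
  eval-𝔹 m H φ = ≈.trans (eval-linear (λ I → concatMap (term I) (upTo (suc (size I)))) H φ) (eval-cong H onBasis)
    where
    X : Composition → ℕ → Sym
    X I i = (F (replicate i (1+ 0)) ⊥) (basis I)
    term : Composition → ℕ → Sym
    term I i = ((- 1#) ^ i) · (S (ℤ.+ suc m ℤ.+ ℤ.+ i) *ˢ X I i)
    φ₊ : ℕ → Composition → Carrier
    φ₊ i J = φ ((1+ (m ℕ.+ i)) ∷ J)

    eval-term : ∀ I i → eval (term I i) φ ≈ (- 1#) ^ i *
                ∑ (splittings (parts I)) (λ (a , b) → coeff (F (replicate i (1+ 0))) a * φ₊ i (nonzeros b))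
    eval-term I i = begin
      eval (term I i) φ
        ≈⟨ eval-· ((- 1#) ^ i) (S (ℤ.+ suc m ℤ.+ ℤ.+ i) *ˢ X I i) φ ⟩
      (- 1#) ^ i * eval (S (ℤ.+ suc m ℤ.+ ℤ.+ i) *ˢ X I i) φ
        ≈⟨ *-congˡ (eval-bilinear (λ I J → basis (I ++ J)) (S (ℤ.+ suc m ℤ.+ ℤ.+ i)) (X I i) φ) ⟩
      (- 1#) ^ i * eval (S (ℤ.+ suc m ℤ.+ ℤ.+ i)) (λ K → eval (X I i) (λ J → eval (basis (K ++ J)) φ))
        -- The index `m + 1 + i` is positive, so `S` is a single generator here.
        ≈⟨ *-congˡ (eval-basis ((1+ (m ℕ.+ i)) ∷ []) (λ K → eval (X I i) (λ J → eval (basis (K ++ J)) φ))) ⟩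
      (- 1#) ^ i * eval (X I i) (λ J → eval (basis ((1+ (m ℕ.+ i)) ∷ J)) φ)
        ≈⟨ *-congˡ (eval-cong (X I i) (λ J → eval-basis _ φ)) ⟩
      (- 1#) ^ i * eval (X I i) (φ₊ i)
        ≈⟨ *-congˡ (eval-⊥ (F (replicate i (1+ 0))) I (φ₊ i)) ⟩
      _ ∎

    onBasis : ∀ I → eval (concatMap (term I) (upTo (suc (size I)))) φ ≈ 𝔹ᵀ m φ I
    onBasis I = begin
      eval (concatMap (term I) is) φ
        ≈⟨ ∑-concatMap (term I) is ⟩
      ∑ is (λ i → eval (term I i) φ)
        ≈⟨ ∑-cong is (λ i → ≈.trans (eval-term I i) (∑-*ˡ ((- 1#) ^ i) ss)) ⟩
      ∑ is (λ i → ∑ ss (λ (a , b) → (- 1#) ^ i * (coeff (F (replicate i (1+ 0))) a * φ₊ i (nonzeros b))))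
        ≈⟨ ∑-comm is ss ⟩
      ∑ ss (λ (a , b) → ∑ is (λ i → (- 1#) ^ i * (coeff (F (replicate i (1+ 0))) a * φ₊ i (nonzeros b))))
        ≈⟨ ∑-cong-∈ ss (λ {(a , b)} ab∈ → ∑-elementary a (suc (size I))
             (s≤s (subst (sum a ≤_) (splittings-sum (parts I) ab∈) (ℕ.m≤m+n (sum a) (sum b))))
             (λ i → φ₊ i (nonzeros b))) ⟩
      𝔹ᵀ m φ I ∎
      where
      is = upTo (suc (size I))
      ss = splittings (parts I)

  -- The immaculate functions span Sym

  E-vanish : ∀ g e → (∀ i b → i ℕ.+ sum b ≡ sum e → g i b ≈ 0#) → E g e ≈ 0#
  E-vanish g e g≈0 = ∑-zero-∈ (splittings e)
    (λ {(a , b)} ab∈ → ≈.trans (*-congˡ (g≈0 (sum a) b (splittings-sum e ab∈))) (zeroʳ _))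

  -- Only the splitting with `a` zero survives. Vanishing is required in the total degree of `e`
  -- alone, which is all that the induction of `𝔖-spans` provides.
  E-head : ∀ g e → (∀ i b → suc i ℕ.+ sum b ≡ sum e → g (suc i) b ≈ 0#) → E g e ≈ g 0 e
  E-head g []          g≈0 = E-[] g
  E-head g (zero ∷ e)  g≈0 = ≈.trans (E-zero g e) (E-head (λ i b → g i (0 ∷ b)) e (λ i b → g≈0 i (0 ∷ b)))
  E-head g (suc k ∷ e) g≈0 = begin
    E g (suc k ∷ e)
      ≈⟨ E-suc g k e ⟩
    E (λ i b → g i (suc k ∷ b)) e - E (λ i b → g (suc i) (k ∷ b)) e
      ≈⟨ +-cong (E-head (λ i b → g i (suc k ∷ b)) e (λ i b eq → g≈0 i (suc k ∷ b) (ahead (suc i) (suc k) b eq)))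
                (-‿cong (E-vanish (λ i b → g (suc i) (k ∷ b)) e (λ i b eq → g≈0 i (k ∷ b) (cong suc (ahead i k b eq))))) ⟩
    g 0 (suc k ∷ e) - 0#
      ≈⟨ ≈.trans (+-congˡ -0#≈0#) (+-identityʳ _) ⟩
    g 0 (suc k ∷ e) ∎
    where
    ahead : ∀ i k b → i ℕ.+ sum b ≡ sum e → i ℕ.+ (k ℕ.+ sum b) ≡ k ℕ.+ sum e
    ahead i k b eq = ≡.trans (≡.sym (ℕ.+-assoc i k (sum b))) (≡.trans (cong (ℕ._+ sum b) (ℕ.+-comm i k))
      (≡.trans (ℕ.+-assoc k i (sum b)) (cong (k ℕ.+_) eq)))

  𝔖-spans : ∀ φ → (∀ I → eval (𝔖 I) φ ≈ 0#) → ∀ K → φ K ≈ 0#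
  𝔖-spans φ 𝔖⊥φ K = bySize (suc (size K)) φ 𝔖⊥φ K ℕ.≤-refl
    where
    -- `φ` varies in the induction: `𝔹ᵀ m φ` annihilates every `𝔖 I` because `φ` annihilates
    -- `𝔖 ((1+ m) ∷ I)`, and it is evaluated at `K`, which is smaller than `(1+ m) ∷ K`.
    bySize : ∀ n φ → (∀ I → eval (𝔖 I) φ ≈ 0#) → ∀ K → size K < n → φ K ≈ 0#
    bySize (suc n) φ 𝔖⊥φ []           _        = ≈.trans (≈.sym (eval-basis [] φ)) (𝔖⊥φ [])
    bySize (suc n) φ 𝔖⊥φ ((1+ m) ∷ K) (s≤s le) = byTail (suc (size K)) m K ℕ.≤-refl le
      where
      -- The other terms of `𝔹ᵀ m φ K` move size from the tail to the first part at constant total,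
      -- so the size of the tail decreases.
      byTail : ∀ s m K → size K < s → m ℕ.+ size K < n → φ ((1+ m) ∷ K) ≈ 0#
      byTail (suc s) m K (s≤s K≤s) le = begin
        φ ((1+ m) ∷ K)
          ≡⟨ ≡.cong₂ (λ l L → φ ((1+ l) ∷ L)) (≡.sym (ℕ.+-identityʳ m)) (≡.sym (nonzeros-parts K)) ⟩
        φ ((1+ (m ℕ.+ 0)) ∷ nonzeros (parts K))
          ≈⟨ E-head (λ i b → φ ((1+ (m ℕ.+ i)) ∷ nonzeros b)) (parts K) smaller ⟨
        𝔹ᵀ m φ K
          ≈⟨ bySize n (𝔹ᵀ m φ) (λ I → ≈.trans (≈.sym (eval-𝔹 m (𝔖 I) φ)) (𝔖⊥φ ((1+ m) ∷ I))) K
               (ℕ.≤-<-trans (ℕ.m≤n+m (size K) m) le) ⟩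
        0# ∎
        where
        smaller : ∀ i b → suc i ℕ.+ sum b ≡ size K → φ ((1+ (m ℕ.+ suc i)) ∷ nonzeros b) ≈ 0#
        smaller i b eq = byTail s (m ℕ.+ suc i) (nonzeros b)
          (ℕ.≤-trans (s≤s (ℕ.≤-trans (ℕ.≤-reflexive (size-nonzeros b)) (ℕ.m≤n+m (sum b) i)))
            (subst (_≤ s) (≡.sym eq) K≤s))
          (subst (_< n) (≡.trans (cong (m ℕ.+_) (≡.trans (≡.sym eq) (cong (suc i ℕ.+_) (≡.sym (size-nonzeros b)))))
            (≡.sym (ℕ.+-assoc m (suc i) (size (nonzeros b))))) le)

  -- The bar involution reverses the variables

  merge : ℕ⁺ → Composition → Composition
  merge i []      = i ∷ []
  merge i (j ∷ I) = (i +⁺ j) ∷ I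

  map-merge : ∀ i j I → map (merge i) (coarsenings⁺ j I) ≡ coarsenings⁺ (i +⁺ j) I
  map-merge i j []      = ≡.refl
  map-merge i j (k ∷ I) = ≡.trans (map-++ (merge i) (map (j ∷_) (coarsenings⁺ k I)) _)
    (≡.cong₂ _++_ (≡.sym (map-∘ (coarsenings⁺ k I)))
      (≡.trans (map-merge i (j +⁺ k) I) (cong (λ l → coarsenings⁺ l I) (≡.sym (+⁺-assoc i j k)))))

  -- Makes the truncated subtraction in the sign exponent of `ribbon` a genuine one.
  length-coarsenings : ∀ i I {J} → J ∈ coarsenings⁺ i I → length J ≤ suc (length I)
  length-coarsenings i []      (here ≡.refl) = s≤s z≤n
  length-coarsenings i (j ∷ I) J∈ with ∈-++⁻ (map (i ∷_) (coarsenings⁺ j I)) J∈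
  ... | inj₁ J∈ˡ with T , T∈ , ≡.refl ← ∈-map⁻ (i ∷_) J∈ˡ = s≤s (length-coarsenings j I T∈)
  ... | inj₂ J∈ʳ = ℕ.m≤n⇒m≤1+n (length-coarsenings (i +⁺ j) I J∈ʳ)

  eval-ribbon : ∀ I φ → eval (ribbon I) φ ≈ ∑ (coarsenings I) (λ J → (- 1#) ^ (length I ∸ length J) * φ J)
  eval-ribbon I φ = ∑-map (λ J → ((- 1#) ^ (length I ∸ length J) , J)) (coarsenings I)

  -- `S_i` times a ribbon is the sum of the ribbons obtained by prepending `i` and by adding `i` to
  -- the first part; merging loses one part and so changes the sign.
  eval-ribbon-∷ : ∀ i j I φ → eval (ribbon (i ∷ j ∷ I)) φ ≈
                  eval (ribbon (j ∷ I)) (φ ∘ (i ∷_)) - eval (ribbon ((i +⁺ j) ∷ I)) φ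
  eval-ribbon-∷ i j I φ = begin
    eval (ribbon (i ∷ j ∷ I)) φ
      ≈⟨ eval-ribbon (i ∷ j ∷ I) φ ⟩
    ∑ (map (i ∷_) (coarsenings⁺ j I) ++ coarsenings⁺ (i +⁺ j) I) f
      ≈⟨ ∑-++ (map (i ∷_) (coarsenings⁺ j I)) ⟩
    ∑ (map (i ∷_) (coarsenings⁺ j I)) f + ∑ (coarsenings⁺ (i +⁺ j) I) f
      ≈⟨ +-cong (≈.trans (∑-map (i ∷_) (coarsenings⁺ j I)) (≈.sym (eval-ribbon (j ∷ I) (φ ∘ (i ∷_)))))
                (≈.trans (∑-cong-∈ (coarsenings⁺ (i +⁺ j) I) (λ {J} → negated J))
                  (≈.trans (∑-neg (coarsenings⁺ (i +⁺ j) I)) (-‿cong (≈.sym (eval-ribbon ((i +⁺ j) ∷ I) φ))))) ⟩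
    eval (ribbon (j ∷ I)) (φ ∘ (i ∷_)) - eval (ribbon ((i +⁺ j) ∷ I)) φ ∎
    where
    f : Composition → Carrier
    f J = (- 1#) ^ (suc (suc (length I)) ∸ length J) * φ J
    negated : ∀ J → J ∈ coarsenings⁺ (i +⁺ j) I → f J ≈ - ((- 1#) ^ (suc (length I) ∸ length J) * φ J)
    negated J J∈ rewrite ℕ.+-∸-assoc 1 (length-coarsenings (i +⁺ j) I J∈) =
      ≈.trans (*-assoc _ _ _) (≈.trans (≈.sym (-‿distribˡ-* 1# _)) (-‿cong (*-identityˡ _)))

  -- By `map-merge`, the merged ribbons subtracted in `eval-ribbon-∷` cancel the coarsenings that
  -- merge the first two parts. This is the ribbon expansion of `S^K`, dual to the expansion of `M`
  -- in the basis `F`.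
  ∑-ribbon : ∀ K φ → ∑ (coarsenings K) (λ I → eval (ribbon I) φ) ≈ φ K
  ∑-ribbon⁺ : ∀ i I φ → ∑ (coarsenings⁺ i I) (λ J → eval (ribbon J) φ) ≈ φ (i ∷ I)
  ∑-ribbon []      φ = ≈.trans (+-identityʳ _) (≈.trans (+-identityʳ _) (*-identityˡ _))
  ∑-ribbon (i ∷ I) φ = ∑-ribbon⁺ i I φ
  ∑-ribbon⁺ i []      φ = ≈.trans (+-identityʳ _) (≈.trans (+-identityʳ _) (*-identityˡ _))
  ∑-ribbon⁺ i (j ∷ I) φ = begin
    ∑ (map (i ∷_) Js ++ coarsenings⁺ (i +⁺ j) I) r
      ≈⟨ ∑-++ (map (i ∷_) Js) ⟩
    ∑ (map (i ∷_) Js) r + X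
      ≈⟨ +-congʳ (∑-map (i ∷_) Js) ⟩
    ∑ Js (r ∘ (i ∷_)) + X
      ≈⟨ +-congʳ (∑-cong-∈ Js split) ⟩
    ∑ Js (λ J → eval (ribbon J) (φ ∘ (i ∷_)) - r (merge i J)) + X
      ≈⟨ +-congʳ (≈.trans (∑-+ Js) (+-cong (∑-ribbon⁺ j I (φ ∘ (i ∷_))) (∑-neg Js))) ⟩
    (φ (i ∷ j ∷ I) - ∑ Js (r ∘ merge i)) + X
      ≈⟨ +-congʳ (+-congˡ (-‿cong (≈.trans (≈.sym (∑-map (merge i) Js))
           (reflexive (cong (λ Ls → ∑ Ls r) (map-merge i j I)))))) ⟩
    (φ (i ∷ j ∷ I) - X) + X
      ≈⟨ ≈.trans (+-assoc _ _ _) (≈.trans (+-congˡ (-‿inverseˡ X)) (+-identityʳ _)) ⟩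
    φ (i ∷ j ∷ I) ∎
    where
    r : Composition → Carrier
    r J = eval (ribbon J) φ
    Js = coarsenings⁺ j I
    X = ∑ (coarsenings⁺ (i +⁺ j) I) r
    split : ∀ {J} → J ∈ Js → r (i ∷ J) ≈ eval (ribbon J) (φ ∘ (i ∷_)) - r (merge i J)
    split J∈ with h , T , ≡.refl , _ ← coarsenings-head j I J∈ = eval-ribbon-∷ i h T φ

  -- Reversing both compositions preserves refinement, so `F (reverse I)` is `F I` in reversed
  -- variables; the ribbon pairings then reassemble `f`.
  coeff-bar : ∀ f e → coeff (bar f) e ≈ coeff f (reverse e)
  coeff-bar f e = begin
    coeff (bar f) e
      ≈⟨ coeff-linearQ (λ I → F (reverse I)) (F-expansion f) e ⟩
    eval (F-expansion f) (λ I → coeff (F (reverse I)) e)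
      ≈⟨ ∑-map (λ I → (⟨ ribbon I , f ⟩ , I)) Is ⟩
    ∑ Is (λ I → ⟨ ribbon I , f ⟩ * 𝟙[ reverse I ∈? coarsenings (nonzeros e) ])
      ≈⟨ ∑-cong Is (λ I → *-congˡ (𝟙-cong (_ ∈? _) (I ∈? coarsenings K) (to I) (from I))) ⟩
    ∑ Is (λ I → ⟨ ribbon I , f ⟩ * 𝟙[ I ∈? coarsenings K ])
      ≈⟨ restrict ⟩
    coeff f (reverse e) ∎
    where
    Is = compositionsUpTo (degree f)
    K = nonzeros (reverse e)
    to : ∀ I → reverse I ∈ coarsenings (nonzeros e) → I ∈ coarsenings K
    to I I∈ = ≡.subst₂ (λ J L → J ∈ coarsenings L) (reverse-involutive I) (≡.sym (reverse-nonzeros e))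
      (reverse-∈-coarsenings (nonzeros e) I∈)
    from : ∀ I → I ∈ coarsenings K → reverse I ∈ coarsenings (nonzeros e)
    from I I∈ = subst (λ L → reverse I ∈ coarsenings L)
      (≡.trans (cong reverse (reverse-nonzeros e)) (reverse-involutive (nonzeros e)))
      (reverse-∈-coarsenings K I∈)
    restrict : ∑ Is (λ I → ⟨ ribbon I , f ⟩ * 𝟙[ I ∈? coarsenings K ]) ≈ coeff f (reverse e)
    restrict with size K ℕ.≤? degree f
    ... | yes K≤ = ≈.trans
      (∑-restrict (compositionsUpTo-unique (degree f)) (coarsenings-unique K)
        (λ I∈ → ∈-compositionsUpTo (degree f) (subst (_≤ degree f) (≡.sym (size-coarsenings K I∈)) K≤)))
      (≈.trans (∑-ribbon K (coeff f ∘ parts)) (quasisymmetric f _ _ (nonzeros-parts K)))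
    -- Above the degree of `f` the truncated expansion contains no coarsening of `K`, and the
    -- coefficient of `f` vanishes as well.
    ... | no K≰ = ≈.trans
      (∑-zero-∈ Is (λ {I} I∈ → ≈.trans (*-congˡ (𝟙-no (I ∈? coarsenings K)
        (λ I∈K → K≰ (subst (_≤ degree f) (size-coarsenings K I∈K) (size-compositionsUpTo (degree f) I∈))))) (zeroʳ _)))
      (≈.sym (bounded f (reverse e) (subst (degree f <_) (size-nonzeros (reverse e)) (ℕ.≰⇒> K≰))))

  -- Counting shuffles with ascending factors

  ⟦_⟧ : Bool → Carrier
  ⟦ true  ⟧ = 1#
  ⟦ false ⟧ = 0#

  χ : Composition → List ℕ → Carrier
  χ I p = ⟦ ascending I p ⟧

  χFrom : ℕ → ℕ → Composition → List ℕ → Carrier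
  χFrom c x I p = ⟦ ascendingFrom c x I p ⟧

  𝟙≈⟦⟧ : ∀ {p} {P : Set p} (P? : Dec P) b → (P → T b) → (T b → P) → 𝟙[ P? ] ≈ ⟦ b ⟧
  𝟙≈⟦⟧ P? true  _  from = 𝟙-yes P? (from tt)
  𝟙≈⟦⟧ P? false to _    = 𝟙-no P? to

  coeff-F-runs : ∀ p e → coeff (F (runs p)) e ≈ χ (nonzeros e) p
  coeff-F-runs p e = 𝟙≈⟦⟧ (runs p ∈? coarsenings (nonzeros e)) (ascending (nonzeros e) p)
    (runs⇒ascending (nonzeros e) p) (ascending⇒runs (nonzeros e) p)

  ascending-map-+ : ∀ j I p → ascending I (map (j ℕ.+_) p) ≡ ascending I p
  ascendingFrom-map-+ : ∀ j c x I p → ascendingFrom c (j ℕ.+ x) I (map (j ℕ.+_) p) ≡ ascendingFrom c x I p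
  ascending-map-+ j []           []      = ≡.refl
  ascending-map-+ j []           (x ∷ p) = ≡.refl
  ascending-map-+ j (i ∷ I)      []      = ≡.refl
  ascending-map-+ j ((1+ c) ∷ I) (x ∷ p) = ascendingFrom-map-+ j c x I p
  ascendingFrom-map-+ j zero    x I p  = ascending-map-+ j I p
  ascendingFrom-map-+ j (suc c) x I [] = ≡.refl
  ascendingFrom-map-+ j (suc c) x I (y ∷ p) with y ℕ.<? x | (j ℕ.+ y) ℕ.<? (j ℕ.+ x)
  ... | yes _   | yes _     = ≡.refl
  ... | no  _   | no  _     = ascendingFrom-map-+ j c y I p
  ... | yes y<x | no  j+y≮  = contradiction (ℕ.+-monoʳ-< j y<x) j+y≮
  ... | no  y≮x | yes j+y<  = contradiction (ℕ.+-cancelˡ-< j _ _ j+y<) y≮x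

  -- If `x` is less than all later letters, comparison with it never fails, so the rest of its
  -- factor may be read as a new factor of `c` letters; for `c = 0`, `nonzeros` drops it.
  χFrom-least : ∀ c {x} e {p} → All (x <_) p → χFrom c x (nonzeros e) p ≈ χ (nonzeros (c ∷ e)) p
  χFrom-least zero    e _  = ≈.refl
  χFrom-least (suc c) e [] = ≈.refl
  χFrom-least (suc c) {x} e {y ∷ p} (x<y ∷ _) with y ℕ.<? x
  ... | yes y<x = contradiction y<x (ℕ.<-asym x<y)
  ... | no  _   = ≈.refl

  χFrom-descent : ∀ c {x y} I p → y < x → χFrom (suc c) x I (y ∷ p) ≈ 0#
  χFrom-descent c {x} {y} I p y<x with y ℕ.<? x
  ... | yes _   = ≈.refl
  ... | no  y≮x = contradiction y<x y≮x

  -- With no parts left the current factor must absorb all of `p`, and an ascent from `x` never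
  -- comes down to `y`.
  χFrom-last : ∀ c x p {y} → y ∈ p → y < x → χFrom c x [] p ≈ 0#
  χFrom-last zero    x (z ∷ p) y∈ y<x = ≈.refl
  χFrom-last (suc c) x (z ∷ p) y∈ y<x with z ℕ.<? x
  ... | yes _ = ≈.refl
  χFrom-last (suc c) x (z ∷ p) (here ≡.refl) y<x | no z≮x = contradiction y<x z≮x
  χFrom-last (suc c) x (z ∷ p) (there y∈)    y<x | no z≮x = χFrom-last c z p y∈ (ℕ.<-≤-trans y<x (ℕ.≮⇒≥ z≮x))

  Separated : List ℕ → List ℕ → Set
  Separated xs ys = AllPairs _<_ xs × All (λ x → All (x <_) ys) xs

  ∑-shuffles-∷ : ∀ {a} {A : Set a} (x : A) xs y ys (f : List A → Carrier) → ∑ (shuffles (x ∷ xs) (y ∷ ys)) f ≈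
                 ∑ (shuffles xs (y ∷ ys)) (f ∘ (x ∷_)) + ∑ (shuffles (x ∷ xs) ys) (f ∘ (y ∷_))
  ∑-shuffles-∷ x xs y ys f = ≈.trans (∑-++ (map (x ∷_) (shuffles xs (y ∷ ys))))
    (+-cong (∑-map (x ∷_) (shuffles xs (y ∷ ys))) (∑-map (y ∷_) (shuffles (x ∷ xs) ys)))

  ∑-shuffles-least : ∀ c {x} xs ys e → All (x <_) xs → All (x <_) ys →
    ∑ (shuffles xs ys) (χFrom c x (nonzeros e)) ≈ ∑ (shuffles xs ys) (χ (nonzeros (c ∷ e)))
  ∑-shuffles-least c xs ys e x<xs x<ys = ∑-cong-∈ (shuffles xs ys)
    (λ zs∈ → χFrom-least c e (↭.All-resp-↭ (↭-sym (shuffles-↭ xs ys zs∈)) (All.++⁺ x<xs x<ys)))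

  -- For nonempty `ys` a shuffle ends with a letter of `xs`, smaller than every letter of `ys`, and
  -- is not ascending; for empty `ys` the only shuffle is `xs`.
  ∑-shuffles-last : ∀ c xs ys → Separated xs ys →
    ∑ (shuffles xs ys) (χ (nonzeros (c ∷ []))) ≈ 𝟙[ c ℕ.≟ length xs ] * χ [] ys
  ∑-shuffles-last zero    []       []       _ = ≈.trans (+-identityʳ _) (≈.sym (*-identityˡ _))
  ∑-shuffles-last (suc c) []       []       _ = ≈.trans (+-identityʳ _) (≈.sym (zeroˡ _))
  ∑-shuffles-last c       []       (y ∷ ys) _ = ≈.sym (zeroʳ _)
  ∑-shuffles-last zero    (x ∷ xs) []       _ = ≈.trans (∑-map (x ∷_) (shuffles xs []))
    (≈.trans (∑-zero-∈ (shuffles xs []) (λ _ → ≈.refl)) (≈.sym (zeroˡ _)))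
  ∑-shuffles-last (suc c) (x ∷ xs) []       (x< ∷ xs< , _ ∷ sep) = begin
    ∑ (shuffles (x ∷ xs) []) (χ ((1+ c) ∷ []))         ≈⟨ ∑-map (x ∷_) (shuffles xs []) ⟩
    ∑ (shuffles xs []) (χFrom c x [])                  ≈⟨ ∑-shuffles-least c xs [] [] x< [] ⟩
    ∑ (shuffles xs []) (χ (nonzeros (c ∷ [])))         ≈⟨ ∑-shuffles-last c xs [] (xs< , sep) ⟩
    𝟙[ c ℕ.≟ length xs ] * χ [] []
      ≈⟨ *-congʳ (𝟙-cong (c ℕ.≟ length xs) (suc c ℕ.≟ suc (length xs)) (cong suc) ℕ.suc-injective) ⟩
    𝟙[ suc c ℕ.≟ suc (length xs) ] * χ [] []           ∎
  ∑-shuffles-last zero    (x ∷ xs) (y ∷ ys) _ = ≈.trans (∑-shuffles-∷ x xs y ys (χ []))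
    (≈.trans (+-cong (∑-zero-∈ (shuffles xs (y ∷ ys)) (λ _ → ≈.refl))
                     (∑-zero-∈ (shuffles (x ∷ xs) ys) (λ _ → ≈.refl)))
      (≈.trans (+-identityˡ _) (≈.sym (zeroˡ _))))
  ∑-shuffles-last (suc c) (x ∷ xs) (y ∷ ys) (x< ∷ xs< , x<ys@(x<y ∷ _) ∷ sep) = begin
    ∑ (shuffles (x ∷ xs) (y ∷ ys)) (χ ((1+ c) ∷ []))
      ≈⟨ ∑-shuffles-∷ x xs y ys (χ ((1+ c) ∷ [])) ⟩
    ∑ (shuffles xs (y ∷ ys)) (χFrom c x []) + ∑ (shuffles (x ∷ xs) ys) (χFrom c y [])
      ≈⟨ +-cong (≈.trans (∑-shuffles-least c xs (y ∷ ys) [] x< x<ys) (∑-shuffles-last c xs (y ∷ ys) (xs< , sep)))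
                (∑-zero-∈ (shuffles (x ∷ xs) ys) (λ {zs} zs∈ → χFrom-last c y zs
                  (↭.∈-resp-↭ (↭-sym (shuffles-↭ (x ∷ xs) ys zs∈)) (here ≡.refl)) x<y)) ⟩
    𝟙[ c ℕ.≟ length xs ] * 0# + 0#
      ≈⟨ ≈.trans (+-identityʳ _) (≈.trans (zeroʳ _) (≈.sym (zeroʳ _))) ⟩
    𝟙[ suc c ℕ.≟ suc (length xs) ] * 0# ∎

  convₛ-vanishˡ : ∀ {h} g e → (∀ s → h s ≈ 0#) → convₛ h g e ≈ 0#
  convₛ-vanishˡ g e h≈0 = ∑-zero-∈ (splittings e) (λ _ → ≈.trans (*-congʳ (h≈0 _)) (zeroˡ _))

  convₛ-vanishʳ : ∀ h {g} e → (∀ b → g b ≈ 0#) → convₛ h g e ≈ 0#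
  convₛ-vanishʳ h e g≈0 = ∑-zero-∈ (splittings e) (λ _ → ≈.trans (*-congˡ (g≈0 _)) (zeroʳ _))

  module _ (m : ℕ) where

    -- convₛ (h t) multiplies by the complete function h_{t-m-1}, read as 0 if t ≤ m.
    h : ℕ → ℕ → Carrier
    h t s = 𝟙[ suc m ℕ.+ s ℕ.≟ t ]

    -- The exponent of the last variable is positive, so the last factor is nonempty and ends where
    -- the shuffle does, with the last letter of `xs`.
    Counted : List ℕ → Set _
    Counted e = ∀ xs ys → Separated xs ys → ∑ (shuffles xs ys) (χ (nonzeros (e ∷ʳ suc m))) ≈
                convₛ (h (length xs)) (λ b → χ (nonzeros b) ys) e

    -- Once a letter of ys has been read, a factor can only ascend through letters of ys.
    ∑-shuffles-greatest : ∀ e → Counted e → ∀ c y x xs ys → Separated (x ∷ xs) ys → All (_< y) (x ∷ xs) →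
      ∑ (shuffles (x ∷ xs) ys) (χFrom c y (nonzeros (e ∷ʳ suc m))) ≈
      convₛ (h (suc (length xs))) (λ b → χFrom c y (nonzeros b) ys) e
    ∑-shuffles-greatest e counted zero y x xs ys sep _ = counted (x ∷ xs) ys sep
    ∑-shuffles-greatest e counted (suc c) y x xs [] sep (x<y ∷ _) = begin
      ∑ (shuffles (x ∷ xs) []) (χFrom (suc c) y (nonzeros (e ∷ʳ suc m)))
        ≈⟨ ∑-map (x ∷_) (shuffles xs []) ⟩
      ∑ (shuffles xs []) (χFrom (suc c) y (nonzeros (e ∷ʳ suc m)) ∘ (x ∷_))
        ≈⟨ ∑-zero-∈ (shuffles xs []) (λ {zs} _ → χFrom-descent c (nonzeros (e ∷ʳ suc m)) zs x<y) ⟩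
      0#
        ≈⟨ convₛ-vanishʳ (h (suc (length xs))) e (λ _ → ≈.refl) ⟨
      _ ∎
    ∑-shuffles-greatest e counted (suc c) y x xs (z ∷ ys) (xs< , sep) (x<y ∷ xs<y) = begin
      ∑ (shuffles (x ∷ xs) (z ∷ ys)) (χFrom (suc c) y I)
        ≈⟨ ∑-shuffles-∷ x xs z ys (χFrom (suc c) y I) ⟩
      ∑ (shuffles xs (z ∷ ys)) (χFrom (suc c) y I ∘ (x ∷_)) + ∑ (shuffles (x ∷ xs) ys) (χFrom (suc c) y I ∘ (z ∷_))
        ≈⟨ +-congʳ (∑-zero-∈ (shuffles xs (z ∷ ys)) (λ {zs} _ → χFrom-descent c I zs x<y)) ⟩
      0# + ∑ (shuffles (x ∷ xs) ys) (χFrom (suc c) y I ∘ (z ∷_))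
        ≈⟨ +-identityˡ _ ⟩
      ∑ (shuffles (x ∷ xs) ys) (χFrom (suc c) y I ∘ (z ∷_))
        ≈⟨ next ⟩
      convₛ (h (suc (length xs))) (λ b → χFrom (suc c) y (nonzeros b) (z ∷ ys)) e ∎
      where
      I = nonzeros (e ∷ʳ suc m)
      next : ∑ (shuffles (x ∷ xs) ys) (χFrom (suc c) y I ∘ (z ∷_)) ≈
             convₛ (h (suc (length xs))) (λ b → χFrom (suc c) y (nonzeros b) (z ∷ ys)) e
      next with z ℕ.<? y
      ... | yes _ = ≈.trans (∑-zero-∈ (shuffles (x ∷ xs) ys) (λ _ → ≈.refl))
        (≈.sym (convₛ-vanishʳ (h (suc (length xs))) e (λ _ → ≈.refl)))
      ... | no  _ = ∑-shuffles-greatest e counted c z x xs ys (xs< , All.map All.tail sep) (All.map All.head sep)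

    -- Shuffles are sorted by their first letter, in parallel with `convₛ-suc`. If it lies in `ys`,
    -- the whole first factor does, and the complete function avoids the first variable; if it is
    -- `x`, it accounts for one factor of the first variable in the complete function.
    count : ∀ e → Counted e
    count []            xs ys sep = ≈.trans (∑-shuffles-last (suc m) xs ys sep) (≈.trans
      (*-congʳ (reflexive (cong (λ n → 𝟙[ n ℕ.≟ length xs ]) (≡.sym (ℕ.+-identityʳ (suc m))))))
      (≈.sym (convₛ-[] (h (length xs)) (λ b → χ (nonzeros b) ys))))
    count (zero ∷ e)    xs ys sep = ≈.trans (count e xs ys sep)
      (≈.sym (convₛ-zero (h (length xs)) (λ b → χ (nonzeros b) ys) e))
    count (suc c ∷ e)   []       []       sep = ≈.trans (+-identityʳ _)
      (≈.sym (convₛ-vanishˡ (λ b → χ (nonzeros b) []) (suc c ∷ e) (λ _ → ≈.refl)))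
    count (suc c ∷ e)   []       (y ∷ ys) sep =
      ≈.sym (convₛ-vanishˡ (λ b → χ (nonzeros b) (y ∷ ys)) (suc c ∷ e) (λ _ → ≈.refl))
    count (suc c ∷ e)   (x ∷ xs) ys       (x< ∷ xs< , x<ys ∷ sep) = begin
      ∑ (shuffles (x ∷ xs) ys) (χ ((1+ c) ∷ I))
        ≈⟨ first ys x<ys sep ⟩
      convₛ (h (suc (length xs))) (λ b → χ ((1+ c) ∷ nonzeros b) ys) e + ∑ (shuffles xs ys) (χFrom c x I)
        ≈⟨ +-congˡ (∑-shuffles-least c xs ys (e ∷ʳ suc m) x< x<ys) ⟩
      convₛ (h (suc (length xs))) (λ b → χ ((1+ c) ∷ nonzeros b) ys) e + ∑ (shuffles xs ys) (χ (nonzeros (c ∷ e ∷ʳ suc m)))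
        ≈⟨ +-congˡ (count (c ∷ e) xs ys (xs< , sep)) ⟩
      convₛ (h (suc (length xs))) (λ b → χ ((1+ c) ∷ nonzeros b) ys) e + convₛ (h (length xs)) (λ b → χ (nonzeros b) ys) (c ∷ e)
        ≈⟨ +-congˡ (conv-cong (c ∷ e) (λ a → shifted (sum a)) (λ _ → ≈.refl)) ⟩
      convₛ (h (suc (length xs))) (λ b → χ ((1+ c) ∷ nonzeros b) ys) e +
        convₛ (h (suc (length xs)) ∘ suc) (λ b → χ (nonzeros b) ys) (c ∷ e)
        ≈⟨ convₛ-suc (h (suc (length xs))) (λ b → χ (nonzeros b) ys) c e ⟨
      convₛ (h (suc (length xs))) (λ b → χ (nonzeros b) ys) (suc c ∷ e) ∎
      where
      I = nonzeros (e ∷ʳ suc m)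
      shifted : ∀ s → h (length xs) s ≈ h (suc (length xs)) (suc s)
      shifted s = 𝟙-cong (suc m ℕ.+ s ℕ.≟ length xs) (suc m ℕ.+ suc s ℕ.≟ suc (length xs))
        (λ eq → cong suc (≡.trans (ℕ.+-suc m s) eq))
        (λ eq → ≡.trans (≡.sym (ℕ.+-suc m s)) (ℕ.suc-injective eq))
      first : ∀ ys → All (x <_) ys → All (λ x → All (x <_) ys) xs →
        ∑ (shuffles (x ∷ xs) ys) (χ ((1+ c) ∷ I)) ≈
        convₛ (h (suc (length xs))) (λ b → χ ((1+ c) ∷ nonzeros b) ys) e + ∑ (shuffles xs ys) (χFrom c x I)
      first []       _            _   = ≈.trans (∑-map (x ∷_) (shuffles xs [])) (≈.trans (≈.sym (+-identityˡ _))
        (+-congʳ (≈.sym (convₛ-vanishʳ (h (suc (length xs))) e (λ _ → ≈.refl)))))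
      first (y ∷ ys) (x<y ∷ x<ys) sep = ≈.trans (∑-shuffles-∷ x xs y ys (χ ((1+ c) ∷ I))) (≈.trans (+-comm _ _)
        (+-congʳ (∑-shuffles-greatest e (count e) c y x xs ys
          (x< ∷ xs< , x<ys ∷ All.map All.tail sep) (x<y ∷ All.map All.head sep))))

  -- The commutative images of the coefficients of the free Bell polynomials

  letters : ∀ {n} → Permutation′ n → List ℕ
  letters σ = map toℕ (positions σ)

  coeff-F-descents : ∀ {n} (σ : Permutation′ n) e →
                     coeff (F (descentComposition (flip σ))) e ≈ χ (nonzeros e) (letters σ)
  coeff-F-descents σ e = ≈.trans
    (reflexive (cong (λ p → coeff (F (runs p)) e) (≡.sym (map-tabulate (σ ⟨$⟩ˡ_) toℕ))))
    (coeff-F-runs (letters σ) e)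

  -- The coefficient of x^e in the commutative image of G_σ.
  coeffᴳ : List ℕ → Perm → Carrier
  coeffᴳ e (_ , σ) = coeff (F (descentComposition (flip σ))) e

  shuffles-[] : ∀ {a} {A : Set a} (xs : List A) → shuffles xs [] ≡ xs ∷ []
  shuffles-[] []       = ≡.refl
  shuffles-[] (x ∷ xs) = cong (map (x ∷_)) (shuffles-[] xs)

  letters-id-sorted : ∀ k → AllPairs _<_ (letters (idₚ {k}))
  letters-id-sorted k = AllPairs.map⁺ (AllPairs.tabulate⁺-< id)

  length-letters-id : ∀ k → length (letters (idₚ {k})) ≡ k
  length-letters-id k = ≡.trans (length-map toℕ (positions (idₚ {k}))) (length-tabulate id)

  count-id : ∀ m k e ys → All (λ x → All (x <_) ys) (letters (idₚ {k})) →
             ∑ (shuffles (letters (idₚ {k})) ys) (χ (nonzeros (e ∷ʳ suc m))) ≈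
             convₛ (h m k) (λ b → χ (nonzeros b) ys) e
  count-id m k e ys below = ≈.trans (count m e (letters (idₚ {k})) ys (letters-id-sorted k , below))
    (reflexive (cong (λ t → convₛ (h m t) (λ b → χ (nonzeros b) ys) e) (length-letters-id k)))

  halfProducts : ∀ {k l} → Permutation′ k → Permutation′ l → List (Permutation′ (k ℕ.+ l))
  halfProducts α β = filter (halfProduct? α β) (permutations _)

  eval-halfProducts : ∀ {k l} (α : Permutation′ k) (β : Permutation′ (suc l)) φ →
                      eval ((k , α) ≺ᴳ (suc l , β)) φ ≈ ∑ (halfProducts α β) (λ γ → φ (k ℕ.+ suc l , γ))
  eval-halfProducts {k} {l} α β φ = ≈.trans (∑-map term (halfProducts α β) {λ (c , γ) → c * φ γ})
    (∑-cong (halfProducts α β) (λ γ → *-identityˡ (φ (k ℕ.+ suc l , γ))))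
    where
    term : Permutation′ (k ℕ.+ suc l) → Carrier × Perm
    term γ = 1# , k ℕ.+ suc l , γ

  eval-≺ᴳ : ∀ m k β e → eval ((k , idₚ) ≺ᴳ β) (coeffᴳ (e ∷ʳ suc m)) ≈ convₛ (h m k) (λ b → coeffᴳ b β) e
  -- The convention for an empty right factor agrees with the general rule, since `xs` is the only
  -- shuffle of `xs` with the empty word.
  eval-≺ᴳ m k (zero , β) e = begin
    eval (G (k , idₚ)) (coeffᴳ (e ∷ʳ suc m))
      ≈⟨ eval-basis (k , idₚ) (coeffᴳ (e ∷ʳ suc m)) ⟩
    coeffᴳ (e ∷ʳ suc m) (k , idₚ)
      ≈⟨ coeff-F-descents (idₚ {k}) (e ∷ʳ suc m) ⟩
    χ (nonzeros (e ∷ʳ suc m)) (letters (idₚ {k}))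
      ≈⟨ +-identityʳ _ ⟨
    ∑ (letters (idₚ {k}) ∷ []) (χ (nonzeros (e ∷ʳ suc m)))
      ≡⟨ cong (λ ps → ∑ ps (χ (nonzeros (e ∷ʳ suc m)))) (≡.sym (shuffles-[] (letters (idₚ {k})))) ⟩
    ∑ (shuffles (letters (idₚ {k})) []) (χ (nonzeros (e ∷ʳ suc m)))
      ≈⟨ count-id m k e [] (All.universal (λ _ → []) _) ⟩
    convₛ (h m k) (λ b → χ (nonzeros b) []) e
      ≈⟨ conv-cong e (λ _ → ≈.refl) (λ b → ≈.sym (coeff-F-descents β b)) ⟩
    convₛ (h m k) (λ b → coeffᴳ b (zero , β)) e ∎
  eval-≺ᴳ m k (suc l , β) e = begin
    eval ((k , idₚ) ≺ᴳ (suc l , β)) (coeffᴳ (e ∷ʳ suc m))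
      ≈⟨ eval-halfProducts (idₚ {k}) β (coeffᴳ (e ∷ʳ suc m)) ⟩
    ∑ γs (λ γ → coeffᴳ (e ∷ʳ suc m) (k ℕ.+ suc l , γ))
      ≈⟨ ∑-cong γs (λ γ → coeff-F-descents γ (e ∷ʳ suc m)) ⟩
    ∑ γs (χ I ∘ letters)
      ≈⟨ ∑-map positions γs ⟨
    ∑ (map positions γs) (χ I ∘ map toℕ)
      ≈⟨ ∑-↭ (positions-halfProduct (idₚ {k}) β) ⟩
    ∑ (shuffles ls rs) (χ I ∘ map toℕ)
      ≈⟨ ∑-map (map toℕ) (shuffles ls rs) ⟨
    ∑ (map (map toℕ) (shuffles ls rs)) (χ I)
      ≡⟨ cong (λ ps → ∑ ps (χ I)) (≡.sym (shuffles-map toℕ ls rs)) ⟩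
    ∑ (shuffles (map toℕ ls) (map toℕ rs)) (χ I)
      ≡⟨ ≡.cong₂ (λ xs ys → ∑ (shuffles xs ys) (χ I)) ls≡ rs≡ ⟩
    ∑ (shuffles (letters (idₚ {k})) (map (k ℕ.+_) (letters β))) (χ I)
      ≈⟨ count-id m k e (map (k ℕ.+_) (letters β)) below ⟩
    convₛ (h m k) (λ b → χ (nonzeros b) (map (k ℕ.+_) (letters β))) e
      ≈⟨ conv-cong e (λ _ → ≈.refl) (λ b → ≈.trans
           (reflexive (cong ⟦_⟧ (ascending-map-+ k (nonzeros b) (letters β))))
           (≈.sym (coeff-F-descents β b))) ⟩
    convₛ (h m k) (λ b → coeffᴳ b (suc l , β)) e ∎
    where
    γs = halfProducts (idₚ {k}) β
    I = nonzeros (e ∷ʳ suc m)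
    ls = lefts (idₚ {k}) β
    rs = rights (idₚ {k}) β
    ls≡ : map toℕ ls ≡ letters (idₚ {k})
    ls≡ = ≡.trans (≡.sym (map-∘ (positions (idₚ {k})))) (map-cong (λ i → Fin.toℕ-↑ˡ i (suc l)) _)
    rs≡ : map toℕ rs ≡ map (k ℕ.+_) (letters β)
    rs≡ = ≡.trans (≡.sym (map-∘ (positions β)))
      (≡.trans (map-cong (λ i → Fin.toℕ-↑ʳ k i) (positions β)) (map-∘ (positions β)))
    below : All (λ x → All (x <_) (map (k ℕ.+_) (letters β))) (letters (idₚ {k}))
    below = All.map⁺ (All.tabulate⁺ (λ i → All.map⁺ (All.universal
      (λ y → ℕ.<-≤-trans (Fin.toℕ<n i) (ℕ.m≤m+n k y)) (letters β))))

  -- The recursion for the coefficients of the free Bell polynomials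

  coeffY : Composition → (Perm → Carrier) → Composition × Perm → Carrier
  coeffY I φ (J , σ) = 𝟙[ J ≟ᶜ I ] * φ σ

  eval-coefficientOfY : ∀ I x φ → eval (coefficientOfY I x) φ ≈ eval x (coeffY I φ)
  eval-coefficientOfY I x φ = ≈.trans
    (∑-map (λ (k , _ , σ) → (k , σ)) (filter (λ (_ , J , _) → J ≟ᶜ I) x))
    (≈.trans (∑-filter (λ (_ , J , _) → J ≟ᶜ I) x) (∑-cong x (λ _ → *-exchange _ _ _)))

  eval-YS-≺ : ∀ i x φ → eval (YS i ≺ x) φ ≈
              eval x (λ (J , β) → eval ((value i , idₚ) ≺ᴳ β) (λ γ → φ (i ∷ J , γ)))
  eval-YS-≺ i x φ = begin
    eval (YS i ≺ x) φ
      ≈⟨ eval-bilinear (λ (I , α) (J , β) → linear (λ γ → basis (I ++ J , γ)) (α ≺ᴳ β)) (YS i) x φ ⟩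
    eval (YS i) (λ (I , α) → eval x (λ (J , β) → eval (linear (λ γ → basis (I ++ J , γ)) (α ≺ᴳ β)) φ))
      ≈⟨ eval-basis (i ∷ [] , (value i , idₚ))
           (λ (I , α) → eval x (λ (J , β) → eval (linear (λ γ → basis (I ++ J , γ)) (α ≺ᴳ β)) φ)) ⟩
    eval x (λ (J , β) → eval (linear (λ γ → basis (i ∷ J , γ)) ((value i , idₚ) ≺ᴳ β)) φ)
      ≈⟨ eval-cong x (λ (J , β) → ≈.trans
           (eval-linear (λ γ → basis (i ∷ J , γ)) ((value i , idₚ) ≺ᴳ β) φ)
           (eval-cong ((value i , idₚ) ≺ᴳ β) (λ γ → eval-basis (i ∷ J , γ) φ))) ⟩
    eval x (λ (J , β) → eval ((value i , idₚ) ≺ᴳ β) (λ γ → φ (i ∷ J , γ))) ∎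

  eval-scale : ∀ {b} {B : Set b} k (x : Free B) (φ : B → Carrier) → eval x (λ y → k * φ y) ≈ k * eval x φ
  eval-scale k x φ = ≈.trans (∑-cong x (λ _ → *-exchange _ _ _)) (≈.sym (∑-*ˡ k x))

  -- Among the summands of `bell (suc n)` only the one beginning with the first letter of the
  -- monomial contributes, and `n ∸ p` is `size J`. This is `C_{iJ} = S_i ≺ C_J`.
  eval-C-∷ : ∀ i J φ → eval (C (i ∷ J)) φ ≈ eval (C J) (λ β → eval ((value i , idₚ) ≺ᴳ β) φ)
  eval-C-∷ i@(1+ p) J φ = begin
    eval (C (i ∷ J)) φ
      ≈⟨ eval-coefficientOfY (i ∷ J) (bell (suc n)) φ ⟩
    eval (bell (suc n)) (coeffY (i ∷ J) φ)
      ≡⟨ cong (λ x → eval x (coeffY (i ∷ J) φ)) (bell-suc n) ⟩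
    eval (concatMap (λ k → YS (1+ toℕ k) ≺ bell (n ∸ toℕ k)) (allFin (suc n))) (coeffY (i ∷ J) φ)
      ≈⟨ ∑-concatMap (λ k → YS (1+ toℕ k) ≺ bell (n ∸ toℕ k)) (allFin (suc n)) ⟩
    ∑ (allFin (suc n)) (λ k → eval (YS (1+ toℕ k) ≺ bell (n ∸ toℕ k)) (coeffY (i ∷ J) φ))
      ≈⟨ ∑-cong (allFin (suc n)) (λ k → eval-YS-≺ (1+ toℕ k) (bell (n ∸ toℕ k)) (coeffY (i ∷ J) φ)) ⟩
    ∑ (allFin (suc n)) (term ∘ toℕ)
      ≈⟨ ∑-pick (Unique.allFin⁺ (suc n)) (∈-allFin (Fin.fromℕ< p<1+n)) other ⟩
    term (toℕ (Fin.fromℕ< p<1+n))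
      ≡⟨ cong term (Fin.toℕ-fromℕ< p<1+n) ⟩
    eval (bell (n ∸ p)) (λ (L , β) → eval ((suc p , idₚ) ≺ᴳ β) (λ γ → 𝟙[ (i ∷ L) ≟ᶜ (i ∷ J) ] * φ γ))
      ≡⟨ cong (λ t → eval (bell t) (λ (L , β) → eval ((suc p , idₚ) ≺ᴳ β) (λ γ → 𝟙[ (i ∷ L) ≟ᶜ (i ∷ J) ] * φ γ)))
           (ℕ.m+n∸m≡n p (size J)) ⟩
    eval (bell (size J)) (λ (L , β) → eval ((suc p , idₚ) ≺ᴳ β) (λ γ → 𝟙[ (i ∷ L) ≟ᶜ (i ∷ J) ] * φ γ))
      ≈⟨ eval-cong (bell (size J)) (λ (L , β) → ≈.trans (eval-scale 𝟙[ (i ∷ L) ≟ᶜ (i ∷ J) ] ((suc p , idₚ) ≺ᴳ β) φ)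
           (*-congʳ (𝟙-cong ((i ∷ L) ≟ᶜ (i ∷ J)) (L ≟ᶜ J) ∷-injectiveʳ (cong (i ∷_))))) ⟩
    eval (bell (size J)) (coeffY J (λ β → eval ((suc p , idₚ) ≺ᴳ β) φ))
      ≈⟨ eval-coefficientOfY J (bell (size J)) (λ β → eval ((suc p , idₚ) ≺ᴳ β) φ) ⟨
    eval (C J) (λ β → eval ((suc p , idₚ) ≺ᴳ β) φ) ∎
    where
    n = p ℕ.+ size J
    p<1+n : p < suc n
    p<1+n = s≤s (ℕ.m≤m+n p (size J))
    term : ℕ → Carrier
    term k = eval (bell (n ∸ k)) (λ (L , β) →
      eval ((suc k , idₚ) ≺ᴳ β) (λ γ → 𝟙[ ((1+ k) ∷ L) ≟ᶜ (i ∷ J) ] * φ γ))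
    other : ∀ {k} → k ≢ Fin.fromℕ< p<1+n → term (toℕ k) ≈ 0#
    other {k} k≢ = eval-zero (bell (n ∸ toℕ k)) (λ (L , β) → eval-zero ((suc (toℕ k) , idₚ) ≺ᴳ β) (λ γ →
      ≈.trans (*-congʳ (𝟙-no (((1+ toℕ k) ∷ L) ≟ᶜ (i ∷ J)) (λ eq → k≢ (Fin.toℕ-injective
        (≡.trans (cong ℕ⁺.pred (∷-injectiveˡ eq)) (≡.sym (Fin.toℕ-fromℕ< p<1+n)))))))
        (zeroˡ _)))

  coeff-image : ∀ I e → coeff (commutativeImage (C I)) e ≈ eval (C I) (coeffᴳ e)
  coeff-image I e = coeff-linearQ (λ (_ , σ) → F (descentComposition (flip σ))) (C I) e

  eval-convₛ : ∀ {b} {B : Set b} (x : Free B) f (g : List ℕ → B → Carrier) e →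
               eval x (λ y → convₛ f (λ b → g b y) e) ≈ convₛ f (λ b → eval x (g b)) e
  eval-convₛ x f g e = ≈.trans (eval-∑ x (splittings e))
    (∑-cong (splittings e) (λ (a , b) → eval-scale (f (sum a)) x (g b)))

  coeff-image-∷ʳ : ∀ i J m e → coeff (commutativeImage (C (i ∷ J))) (e ∷ʳ suc m) ≈
                   convₛ (h m (value i)) (coeff (commutativeImage (C J))) e
  coeff-image-∷ʳ i J m e = begin
    coeff (commutativeImage (C (i ∷ J))) (e ∷ʳ suc m)
      ≈⟨ coeff-image (i ∷ J) (e ∷ʳ suc m) ⟩
    eval (C (i ∷ J)) (coeffᴳ (e ∷ʳ suc m))
      ≈⟨ eval-C-∷ i J (coeffᴳ (e ∷ʳ suc m)) ⟩
    eval (C J) (λ β → eval ((value i , idₚ) ≺ᴳ β) (coeffᴳ (e ∷ʳ suc m)))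
      ≈⟨ eval-cong (C J) (λ β → eval-≺ᴳ m (value i) β e) ⟩
    eval (C J) (λ β → convₛ (h m (value i)) (λ b → coeffᴳ b β) e)
      ≈⟨ eval-convₛ (C J) (h m (value i)) coeffᴳ e ⟩
    convₛ (h m (value i)) (λ b → eval (C J) (coeffᴳ b)) e
      ≈⟨ conv-cong e (λ _ → ≈.refl) (λ b → ≈.sym (coeff-image J b)) ⟩
    convₛ (h m (value i)) (coeff (commutativeImage (C J))) e ∎

  coeffᴳ-[] : ∀ {n} (σ : Permutation′ (suc n)) → coeffᴳ [] (suc n , σ) ≈ 0#
  coeffᴳ-[] σ = coeff-F-descents σ []

  -- The recursion on the last variable sees only positive exponents, so the constant term is
  -- treated separately.
  coeff-image-∷-[] : ∀ i J → coeff (commutativeImage (C (i ∷ J))) [] ≈ 0#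
  coeff-image-∷-[] i J = ≈.trans (coeff-image (i ∷ J) []) (≈.trans (eval-C-∷ i J (coeffᴳ []))
    (eval-zero (C J) vanish))
    where
    vanish : ∀ β → eval ((value i , idₚ) ≺ᴳ β) (coeffᴳ []) ≈ 0#
    vanish (zero , β)  = ≈.trans (eval-basis (value i , idₚ) (coeffᴳ [])) (coeffᴳ-[] (idₚ {value i}))
    vanish (suc l , β) = ≈.trans (eval-halfProducts (idₚ {value i}) β (coeffᴳ []))
      (∑-zero-∈ (halfProducts (idₚ {value i}) β) (λ {γ} _ → coeffᴳ-[] γ))

  coeff-image-[] : ∀ e → coeff (commutativeImage (C [])) e ≈ χ (nonzeros e) []
  coeff-image-[] e = ≈.trans (coeff-image [] e) (≈.trans (eval-basis (0 , idₚ) (coeffᴳ e)) (coeff-F-descents (idₚ {0}) e))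

  -- The dual immaculate basis

  D : Composition → QSym
  D I = bar (commutativeImage (C I))

  sum-reverse : ∀ a → sum (reverse a) ≡ sum a
  sum-reverse a = sum-↭ (↭.↭-reverse a)

  coeff-D-∷ : ∀ i J m e → coeff (D (i ∷ J)) (suc m ∷ e) ≈ convₛ (h m (value i)) (coeff (D J)) e
  coeff-D-∷ i J m e = begin
    coeff (D (i ∷ J)) (suc m ∷ e)
      ≈⟨ coeff-bar (commutativeImage (C (i ∷ J))) (suc m ∷ e) ⟩
    coeff (commutativeImage (C (i ∷ J))) (reverse (suc m ∷ e))
      ≡⟨ cong (coeff (commutativeImage (C (i ∷ J)))) (unfold-reverse (suc m) e) ⟩
    coeff (commutativeImage (C (i ∷ J))) (reverse e ∷ʳ suc m)
      ≈⟨ coeff-image-∷ʳ i J m (reverse e) ⟩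
    convₛ (h m (value i)) (coeff (commutativeImage (C J))) (reverse e)
      ≈⟨ conv-reverse (h m (value i) ∘ sum) (coeff (commutativeImage (C J))) e ⟩
    conv (h m (value i) ∘ sum ∘ reverse) (coeff (commutativeImage (C J)) ∘ reverse) e
      ≈⟨ conv-cong e (λ a → reflexive (cong (h m (value i)) (sum-reverse a)))
                     (λ b → ≈.sym (coeff-bar (commutativeImage (C J)) b)) ⟩
    convₛ (h m (value i)) (coeff (D J)) e ∎

  coeff-D-[]-∷ : ∀ m e → coeff (D []) (suc m ∷ e) ≈ 0#
  coeff-D-[]-∷ m e = ≈.trans (coeff-bar (commutativeImage (C [])) (suc m ∷ e))
    (≈.trans (coeff-image-[] (reverse (suc m ∷ e))) (reflexive (cong ⟦_⟧ notEmpty)))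
    where
    notEmpty : ascending (nonzeros (reverse (suc m ∷ e))) [] ≡ false
    notEmpty rewrite reverse-nonzeros (suc m ∷ e) | unfold-reverse (1+ m) (nonzeros e)
      with reverse (nonzeros e)
    ... | []    = ≡.refl
    ... | _ ∷ _ = ≡.refl

  coeff-D-∅ : ∀ J → coeff (D J) [] ≈ 𝟙[ [] ≟ᶜ J ]
  coeff-D-∅ []      = ≈.trans (coeff-bar (commutativeImage (C [])) []) (coeff-image-[] [])
  coeff-D-∅ (j ∷ J) = ≈.trans (coeff-bar (commutativeImage (C (j ∷ J))) []) (coeff-image-∷-[] j J)

  -- `𝔹ᵀ` takes its arguments through `nonzeros`, whereas `coeff-D-∷` speaks of exponent vectors.
  coeff-D-parts : ∀ J m b → coeff (D J) (suc m ∷ parts (nonzeros b)) ≈ coeff (D J) (suc m ∷ b)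
  coeff-D-parts J m b = quasisymmetric (D J) _ _ (cong ((1+ m) ∷_) (nonzeros-parts (nonzeros b)))

  𝔹ᵀ-D-[] : ∀ m K → 𝔹ᵀ m (coeff (D []) ∘ parts) K ≈ 0#
  𝔹ᵀ-D-[] m K = E-vanish (λ i b → coeff (D []) (parts ((1+ (m ℕ.+ i)) ∷ nonzeros b))) (parts K)
    (λ i b _ → coeff-D-[]-∷ (m ℕ.+ i) (parts (nonzeros b)))

  𝔹ᵀ-D-∷ : ∀ m j J K → 𝔹ᵀ m (coeff (D (j ∷ J)) ∘ parts) K ≈ 𝟙[ (1+ m) ≟⁺ j ] * coeff (D J) (parts K)
  𝔹ᵀ-D-∷ m j@(1+ n) J K = begin
    E (λ i b → coeff (D (j ∷ J)) (suc (m ℕ.+ i) ∷ parts (nonzeros b))) (parts K)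
      -- Raising the first exponent by `i` shifts the argument of `h` by `i`, which gives the family
      -- the form required by `E-convₛ`.
      ≈⟨ E-cong (parts K) (λ i b → ≈.trans (coeff-D-parts (j ∷ J) (m ℕ.+ i) b) (≈.trans
           (coeff-D-∷ j J (m ℕ.+ i) b)
           (conv-cong b (λ a → reflexive (cong (λ t → 𝟙[ suc t ℕ.≟ suc n ]) (ℕ.+-assoc m i (sum a)))) (λ _ → ≈.refl)))) ⟩
    E (λ i → convₛ (λ s → h m (suc n) (i ℕ.+ s)) (coeff (D J))) (parts K)
      ≈⟨ E-convₛ (h m (suc n)) (coeff (D J)) (parts K) ⟩
    h m (suc n) 0 * coeff (D J) (parts K)
      ≈⟨ *-congʳ (𝟙-cong (suc (m ℕ.+ 0) ℕ.≟ suc n) ((1+ m) ≟⁺ j)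
           (λ eq → cong 1+_ (≡.trans (≡.sym (ℕ.+-identityʳ m)) (ℕ.suc-injective eq)))
           (λ { ≡.refl → cong suc (ℕ.+-identityʳ m) })) ⟩
    𝟙[ (1+ m) ≟⁺ j ] * coeff (D J) (parts K) ∎

  D-isDualImmaculate : IsDualImmaculate D
  D-isDualImmaculate [] J = ≈.trans (eval-basis [] (coeff (D J) ∘ parts)) (coeff-D-∅ J)
  D-isDualImmaculate ((1+ m) ∷ I) [] = ≈.trans (eval-𝔹 m (𝔖 I) (coeff (D []) ∘ parts))
    (eval-zero (𝔖 I) (𝔹ᵀ-D-[] m))
  D-isDualImmaculate ((1+ m) ∷ I) (j ∷ J) = begin
    eval (𝔹 (ℤ.+ suc m) (𝔖 I)) (coeff (D (j ∷ J)) ∘ parts)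
      ≈⟨ eval-𝔹 m (𝔖 I) (coeff (D (j ∷ J)) ∘ parts) ⟩
    eval (𝔖 I) (𝔹ᵀ m (coeff (D (j ∷ J)) ∘ parts))
      ≈⟨ eval-cong (𝔖 I) (𝔹ᵀ-D-∷ m j J) ⟩
    eval (𝔖 I) (λ K → 𝟙[ (1+ m) ≟⁺ j ] * coeff (D J) (parts K))
      ≈⟨ eval-scale 𝟙[ (1+ m) ≟⁺ j ] (𝔖 I) (coeff (D J) ∘ parts) ⟩
    𝟙[ (1+ m) ≟⁺ j ] * ⟨ 𝔖 I , D J ⟩
      ≈⟨ *-congˡ (D-isDualImmaculate I J) ⟩
    𝟙[ (1+ m) ≟⁺ j ] * 𝟙[ I ≟ᶜ J ]
      ≈⟨ 𝟙-* ((1+ m) ≟⁺ j) (I ≟ᶜ J) (((1+ m) ∷ I) ≟ᶜ (j ∷ J)) (≡.cong₂ _∷_) ∷-injective ⟩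
    𝟙[ ((1+ m) ∷ I) ≟ᶜ (j ∷ J) ] ∎

  -- The difference of the two candidates, as a functional on `Sym`, annihilates every `𝔖 J` and
  -- hence every `S^K`.
  dualImmaculate-unique : ∀ 𝔖* 𝔗* → IsDualImmaculate 𝔖* → IsDualImmaculate 𝔗* → ∀ I → 𝔖* I ≋ 𝔗* I
  dualImmaculate-unique 𝔖* 𝔗* dualS dualT I e = begin
    coeff (𝔖* I) e
      ≈⟨ quasisymmetric (𝔖* I) _ _ (nonzeros-parts (nonzeros e)) ⟨
    coeff (𝔖* I) (parts K)
      ≈⟨ x∙y⁻¹≈ε⇒x≈y _ _ (𝔖-spans φ orthogonal K) ⟩
    coeff (𝔗* I) (parts K)
      ≈⟨ quasisymmetric (𝔗* I) _ _ (nonzeros-parts (nonzeros e)) ⟩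
    coeff (𝔗* I) e ∎
    where
    K = nonzeros e
    φ : Composition → Carrier
    φ L = coeff (𝔖* I) (parts L) - coeff (𝔗* I) (parts L)
    orthogonal : ∀ J → eval (𝔖 J) φ ≈ 0#
    orthogonal J = begin
      eval (𝔖 J) φ
        ≈⟨ ∑-cong (𝔖 J) (λ _ → ≈.trans (distribˡ _ _ _) (+-congˡ (≈.sym (-‿distribʳ-* _ _)))) ⟩
      ∑ (𝔖 J) (λ (k , L) → k * coeff (𝔖* I) (parts L) - k * coeff (𝔗* I) (parts L))
        ≈⟨ ≈.trans (∑-+ (𝔖 J)) (+-congˡ (∑-neg (𝔖 J))) ⟩
      ⟨ 𝔖 J , 𝔖* I ⟩ - ⟨ 𝔖 J , 𝔗* I ⟩
        ≈⟨ +-cong (dualS J I) (-‿cong (dualT J I)) ⟩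
      𝟙[ J ≟ᶜ I ] - 𝟙[ J ≟ᶜ I ]
        ≈⟨ -‿inverseʳ _ ⟩
      0# ∎

theorem3p6 : ∀ {c ℓ₁ ℓ₂} (K : HeytingField c ℓ₁ ℓ₂) → CharacteristicZero K →
    let open Over (commutativeRing K) in
    IsDualImmaculate (λ I → bar (commutativeImage (C I)))
    × (∀ 𝔖* → IsDualImmaculate 𝔖* → ∀ I → 𝔖* I ≋ bar (commutativeImage (C I)))
theorem3p6 K _ = D-isDualImmaculate R ,
  λ 𝔖* dual → dualImmaculate-unique R 𝔖* (D R) dual (D-isDualImmaculate R)
  where
  R : CommutativeRing _ _
  R = commutativeRing K
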